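{- For every $k$ with $2 \le k \le n$ (where $k$ may depend on $n$), the worst-case approximation ratio of the grammar-based compressor BISECTION satisfies $$\alpha_{\mathrm{BI}}(k,n) \in \Theta\left(\sqrt{n/\log n}\right).$$ That is, there are constants $c_1,c_2>0$ and $n_0$ such that for all $n\ge n_0$ and all $k$ with $2\le k\le n$ we have $c_1\sqrt{n/\log n}\le \alpha_{\mathrm{BI}}(k,n)\le c_2\sqrt{n/\log n}$.
   Context: A straight-line program (SLP) over a finite alphabet $\Sigma$ is a context-free grammar $\mathbb{A}=(N,\Sigma,P,S)$ with a finite set $N$ of nonterminals ($N\cap\Sigma=\emptyset$), start nonterminal $S\in N$, and a finite set $P$ of productions $A\to w$ with $A\in N$, $w\in(N\cup\Sigma)^+$, such that (i) for every $A\in N$ there is exactly one production with left-hand side $A$, and (ii) the relation $\{(A,B)\in N\times N \mid (A\to w)\in P,\ B \text{ occurs in } w\}$ is acyclic. Every nonterminal $A$ produces a unique word $\mathrm{val}(A)\in\Sigma^+$, and $\mathrm{val}(\mathbb{A})=\mathrm{val}(S)$. The size of $\mathbb{A}$ is $|\mathbb{A}|=\sum_{(A\to w)\in P}|w|$. For a nonempty word $w$, $g(w)$ denotes the size of a smallest SLP producing $w$. A grammar-based compressor $\mathcal{C}$ computes for each nonempty word $w$ an SLP $\mathcal{C}(w)$ with $\mathrm{val}(\mathcal{C}(w))=w$. With $[1,k]=\{1,\dots,k\}$, its worst-case approximation ratio is $$\alpha_{\mathcal{C}}(k,n)=\max\{|\mathcal{C}(w)|/g(w) \mid w\in[1,k]^n\}.$$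 BISECTION: an input word $w$ with $|w|\ge 2$ is split as $w=w_1w_2$ with $|w_1|=2^j$, where $j\ge 0$ is the unique number with $2^j<|w|\le 2^{j+1}$. This is repeated recursively with $w_1$ and $w_2$ until words of length $1$ are obtained. One nonterminal is introduced for each distinct word of length at least two that arises in this process (including $w$ itself, whose nonterminal is the start nonterminal), and its rule has a right-hand side consisting of exactly two symbols corresponding to the two parts of its split (a part of length $1$ is represented by the corresponding terminal, a longer part by its nonterminal). For $|w|=1$ the SLP is $S\to w$. The approximation ratio of BISECTION is denoted $\alpha_{\mathrm{BI}}$. -}

module Defs where

open import Data.Fin using (Fin; zero; suc; toℕ) renaming (_<_ to _<ᶠ_)
import Data.Fin.Properties as Fin
open import Data.Fin.Induction using (spo-noetherian)
import Data.Integer as ℤ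
open import Data.List using (List; []; _∷_; _++_; length; cartesianProductWith; allFin; deduplicate)
open import Data.List renaming (lookup to lookupᴸ; map to mapᴸ) using ()
import Data.List.Properties as List
open import Data.List.Extrema using (max)
open import Data.List.Membership.Propositional using (_∈_)
open import Data.List.Membership.Propositional.Properties using (∈-lookup; ∈-deduplicate⁺; ∈-deduplicate⁻; ∈-++⁺ˡ; ∈-++⁺ʳ; ∈-++⁻)
import Data.List.Membership.DecPropositional as DecMembership
open import Data.List.NonEmpty using (List⁺; _∷_; toList) renaming (length to length⁺)
open import Data.List.Relation.Unary.Any using (here; there; index)
open import Data.List.Relation.Unary.Any.Properties using (lookup-index)
open import Data.Nat using (ℕ; zero; suc; _+_; _*_; _^_; _≤_; _<_; z≤n; s≤s; z<s; s<s; NonZero; >-nonZero; _≤?_; _≟_)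
open import Data.Nat.Induction using (<-wellFounded)
import Data.Nat.Properties as ℕ
open import Data.Product using (Σ; ∃; ∃₂; Σ-syntax; ∃-syntax; _×_; _,_; proj₁; proj₂)
open import Data.Rational using (ℚ; 0ℚ; _/_; ↥_; ↧ₙ_) renaming (_≤_ to _≤ℚ_; _<_ to _<ℚ_; _*_ to _*ℚ_)
import Data.Rational.Properties as ℚ
open import Data.Sum using (_⊎_; inj₁; inj₂)
import Data.Sum.Properties as Sum
open import Data.Unit using (⊤; tt)
open import Data.Vec using (Vec; []; _∷_; lookup; tabulate; foldr)
import Data.Vec.Properties as Vec
open import Function using (_∘_; flip; _on_)
open import Induction.WellFounded using (Acc; acc; WellFounded)
open import Relation.Binary.Construct.Closure.Transitive using (TransClosure; [_]; _∷_) renaming (_++_ to _++⁺_)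
open import Relation.Binary.Bundles using (DecTotalOrder)
open import Relation.Binary.Definitions using (DecidableEquality)
open import Relation.Binary.PropositionalEquality using (_≡_; refl; sym; trans; cong; cong₂; subst; isEquivalence)
open import Relation.Nullary using (¬_; Dec; yes; no; contradiction)
open import Relation.Nullary.Decidable using (map′; _×-dec_)

Word : ℕ → Set
Word k = List⁺ (Fin k)

Symbol : ℕ → ℕ → Set
Symbol N k = Fin N ⊎ Fin k

-- One production per nonterminal: entry A is the right-hand side of A.
Rules : ℕ → ℕ → Set
Rules N k = Vec (List⁺ (Symbol N k)) N

private variable
  k N : ℕ

rhs : Rules N k → Fin N → List (Symbol N k)
rhs R A = toList (lookup R A)

infix 4 _⊢_▷_ _⊢_⇒_

_⊢_▷_ : Rules N k → Fin N → Fin N → Set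
R ⊢ A ▷ B = inj₁ B ∈ rhs R A

Acyclic : Rules N k → Set
Acyclic R = ∀ A → ¬ TransClosure (R ⊢_▷_) A A

record SLP (k : ℕ) : Set where
  field
    {#N}    : ℕ
    rules   : Rules #N k
    start   : Fin #N
    acyclic : Acyclic rules

rulesSize : ∀ {n} → Vec (List⁺ (Symbol N k)) n → ℕ
rulesSize = foldr _ (λ w s → length⁺ w + s) 0

size : SLP k → ℕ
size 𝔸 = rulesSize (SLP.rules 𝔸)

-- Derivability of terminal words from strings of symbols, so that val(A) is the
-- unique w with R ⊢ rhs R A ⇒ w.
data _⊢_⇒_ (R : Rules N k) : List (Symbol N k) → List (Fin k) → Set where
  done        : R ⊢ [] ⇒ []
  terminal    : ∀ {a ss w} → R ⊢ ss ⇒ w → R ⊢ inj₂ a ∷ ss ⇒ a ∷ w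
  nonterminal : ∀ {A ss u w} → R ⊢ rhs R A ⇒ u → R ⊢ ss ⇒ w → R ⊢ inj₁ A ∷ ss ⇒ u ++ w

⇒-functional : ∀ {R : Rules N k} {ss u v} → R ⊢ ss ⇒ u → R ⊢ ss ⇒ v → u ≡ v
⇒-functional done              done                = refl
⇒-functional (terminal d)      (terminal d′)       = cong (_ ∷_) (⇒-functional d d′)
⇒-functional (nonterminal d e) (nonterminal d′ e′) =
  cong₂ _++_ (⇒-functional d d′) (⇒-functional e e′)

▷-wellFounded : (R : Rules N k) → Acyclic R → WellFounded (flip (TransClosure (R ⊢_▷_)))
▷-wellFounded R acyclic = spo-noetherian record
  { isEquivalence = isEquivalence
  ; irrefl        = λ { refl → acyclic _ }
  ; trans         = _++⁺_
  ; <-resp-≈      = (λ { refl p → p }) , (λ { refl p → p })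
  }

⇒-totalString : (R : Rules N k) (ss : List (Symbol N k)) →
  (∀ {B} → inj₁ B ∈ ss → ∃ λ w → R ⊢ rhs R B ⇒ w) → ∃ λ w → R ⊢ ss ⇒ w
⇒-totalString R []            f = [] , done
⇒-totalString R (inj₂ a ∷ ss) f with w , d ← ⇒-totalString R ss (f ∘ there) = a ∷ w , terminal d
⇒-totalString R (inj₁ A ∷ ss) f
  with u , d ← f (here refl) | w , e ← ⇒-totalString R ss (f ∘ there) = u ++ w , nonterminal d e

⇒-total : (R : Rules N k) → Acyclic R → ∀ A → ∃ λ w → R ⊢ rhs R A ⇒ w
⇒-total R acyclic A = go A (▷-wellFounded R acyclic A)
  where
  go : ∀ A → Acc (flip (TransClosure (R ⊢_▷_))) A → ∃ λ w → R ⊢ rhs R A ⇒ w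
  go A (acc rs) = ⇒-totalString R (rhs R A) λ {B} B∈ → go B (rs [ B∈ ])

val : SLP k → List (Fin k)
val 𝔸 = proj₁ (⇒-total (SLP.rules 𝔸) (SLP.acyclic 𝔸) (SLP.start 𝔸))

val-derives : (𝔸 : SLP k) → SLP.rules 𝔸 ⊢ rhs (SLP.rules 𝔸) (SLP.start 𝔸) ⇒ val 𝔸
val-derives 𝔸 = proj₂ (⇒-total (SLP.rules 𝔸) (SLP.acyclic 𝔸) (SLP.start 𝔸))

val-unique : (𝔸 : SLP k) → ∀ {w} → SLP.rules 𝔸 ⊢ rhs (SLP.rules 𝔸) (SLP.start 𝔸) ⇒ w → val 𝔸 ≡ w
val-unique 𝔸 = ⇒-functional (val-derives 𝔸)

Produces : SLP k → Word k → Set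
Produces 𝔸 w = val 𝔸 ≡ toList w

Compressor : Set
Compressor = ∀ {k} (w : Word k) → Σ[ 𝔸 ∈ SLP k ] Produces 𝔸 w

record Split (w : Word k) : Set where
  field
    j           : ℕ
    2^j<|w|     : 2 ^ j < length⁺ w
    |w|≤2^1+j   : length⁺ w ≤ 2 ^ suc j
    left right  : Word k
    left++right : toList left ++ toList right ≡ toList w
    |left|      : length⁺ left ≡ 2 ^ j

  |w|≡ : length⁺ left + length⁺ right ≡ length⁺ w
  |w|≡ = trans (sym (List.length-++ (toList left))) (cong length left++right)

  left< : length⁺ left < length⁺ w
  left< = subst (length⁺ left <_) |w|≡ (ℕ.m<m+n _ z<s)

  right< : length⁺ right < length⁺ w
  right< = subst (length⁺ right <_) |w|≡ (ℕ.m<n+m _ z<s)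

splitPoint : ∀ m → ∃ λ j → 2 ^ j < 2 + m × 2 + m ≤ 2 ^ suc j
splitPoint zero    = 0 , s<s z<s , ℕ.≤-refl
splitPoint (suc m) with splitPoint m
... | j , lo , hi with 3 + m ≤? 2 ^ suc j
...   | yes p = j , ℕ.m<n⇒m<1+n lo , p
...   | no ¬p = suc j , ℕ.≰⇒> ¬p , ℕ.≤-trans (ℕ.+-mono-≤ {1} (ℕ.m^n>0 2 (suc j)) hi)
    (ℕ.≤-reflexive (cong (2 ^ suc j +_) (sym (ℕ.+-identityʳ _))))

splitAt⁺ : ∀ (w : Word k) p → 0 < p → p < length⁺ w →
  ∃₂ λ (u v : Word k) → toList u ++ toList v ≡ toList w × length⁺ u ≡ p
splitAt⁺ (a ∷ b ∷ t) (suc zero)    _ _         = (a ∷ []) , (b ∷ t) , refl , refl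
splitAt⁺ (a ∷ b ∷ t) (suc (suc p)) _ (s≤s p<)
  with u , v , eq , len ← splitAt⁺ (b ∷ t) (suc p) z<s p<
  = (a ∷ toList u) , v , cong (a ∷_) eq , cong suc len
splitAt⁺ (a ∷ [])    (suc p)       _ (s≤s ())

split : (a b : Fin k) (t : List (Fin k)) → Split (a ∷ b ∷ t)
split a b t
  with j , lo , hi ← splitPoint (length t)
  with u , v , eq , len ← splitAt⁺ (a ∷ b ∷ t) (2 ^ j) (ℕ.m^n>0 2 j) lo
  = record { j = j ; 2^j<|w| = lo ; |w|≤2^1+j = hi ; left = u ; right = v ; left++right = eq ; |left| = len }

-- The words of length at least two that arise from w, with repetitions.
arising′ : (w : Word k) → Acc _<_ (length⁺ w) → List (Word k)
arising′ (a ∷ [])          _        = []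
arising′ w@(a ∷ b ∷ t) (acc rs) =
  w ∷ arising′ left (rs left<) ++ arising′ right (rs right<)
  where open Split (split a b t)

arising : Word k → List (Word k)
arising w = arising′ w (<-wellFounded (length⁺ w))

_≟ʷ_ : DecidableEquality (Word k)
(a ∷ s) ≟ʷ (b ∷ t) = map′ (λ { (refl , refl) → refl }) (λ { refl → refl , refl })
  (a Fin.≟ b ×-dec List.≡-dec Fin._≟_ s t)

data Long {k} : Word k → Set where
  long : ∀ a b t → Long (a ∷ b ∷ t)

split′ : {w : Word k} → Long w → Split w
split′ (long a b t) = split a b t

Closed : List (Word k) → Set
Closed D = ∀ {w} → w ∈ D → Σ[ l ∈ Long w ]
  (Long (Split.left (split′ l)) → Split.left (split′ l) ∈ D) ×
  (Long (Split.right (split′ l)) → Split.right (split′ l) ∈ D)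

arising-head : (w : Word k) → Long w → ∀ a → w ∈ arising′ w a
arising-head _ (long a b t) (acc rs) = here refl

arising-closed : (w : Word k) → ∀ a → Closed (arising′ w a)
arising-closed (a ∷ b ∷ t) (acc rs) (here refl) = long a b t ,
  (λ l → there (∈-++⁺ˡ (arising-head _ l _))) ,
  (λ l → there (∈-++⁺ʳ (arising′ (Split.left (split a b t)) _) (arising-head _ l _)))
arising-closed (a ∷ b ∷ t) (acc rs) (there w∈)
  with ∈-++⁻ (arising′ (Split.left (split a b t)) (rs (Split.left< (split a b t)))) w∈
... | inj₁ w∈ˡ with l , p , q ← arising-closed _ (rs _) w∈ˡ =
      l , (there ∘ ∈-++⁺ˡ ∘ p) , (there ∘ ∈-++⁺ˡ ∘ q)
... | inj₂ w∈ʳ with l , p , q ← arising-closed _ (rs _) w∈ʳ =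
      l , (there ∘ ∈-++⁺ʳ _ ∘ p) , (there ∘ ∈-++⁺ʳ _ ∘ q)

deduplicate-closed : (D : List (Word k)) → Closed D → Closed (deduplicate _≟ʷ_ D)
deduplicate-closed D closed w∈ with l , p , q ← closed (∈-deduplicate⁻ _≟ʷ_ D w∈) =
  l , (∈-deduplicate⁺ _≟ʷ_ ∘ p) , (∈-deduplicate⁺ _≟ʷ_ ∘ q)

arisingDistinct : Word k → List (Word k)
arisingDistinct w = deduplicate _≟ʷ_ (arising w)

arisingDistinct-closed : (w : Word k) → Closed (arisingDistinct w)
arisingDistinct-closed w = deduplicate-closed (arising w) (arising-closed w (<-wellFounded (length⁺ w)))

-- The grammar whose nonterminals are the positions of D, with one binary
-- rule for each word in D.
module BisectionGrammar {k} (D : List (Word k)) (closed : Closed D) where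

  wordOf : Fin (length D) → Word k
  wordOf = lookupᴸ D

  symbol : (w : Word k) → (Long w → w ∈ D) → Symbol (length D) k
  symbol (a ∷ [])    _  = inj₂ a
  symbol (a ∷ b ∷ t) w∈ = inj₁ (index (w∈ (long a b t)))

  isLong : ∀ i → Long (wordOf i)
  isLong i = proj₁ (closed (∈-lookup {xs = D} i))

  splitOf : ∀ i → Split (wordOf i)
  splitOf i = split′ (isLong i)

  rule : Fin (length D) → List⁺ (Symbol (length D) k)
  rule i = symbol (Split.left (splitOf i)) (proj₁ (proj₂ (closed (∈-lookup i))))
         ∷ symbol (Split.right (splitOf i)) (proj₂ (proj₂ (closed (∈-lookup i))))
         ∷ []

  rules : Rules (length D) k
  rules = tabulate rule

  rhs≡ : ∀ i → rhs rules i ≡ toList (rule i)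
  rhs≡ i = cong toList (Vec.lookup∘tabulate rule i)

  index-word : ∀ {w} (p : w ∈ D) → wordOf (index p) ≡ w
  index-word p = sym (lookup-index p)

  symbol-length : ∀ w w∈ {B} → inj₁ B ≡ symbol w w∈ → length⁺ (wordOf B) ≡ length⁺ w
  symbol-length (a ∷ b ∷ t) w∈ refl = cong length⁺ (index-word (w∈ (long a b t)))

  ▷-length : ∀ {A B} → rules ⊢ A ▷ B → length⁺ (wordOf B) < length⁺ (wordOf A)
  ▷-length {A} {B} p with subst (inj₁ B ∈_) (rhs≡ A) p
  ... | here eq         = ℕ.≤-<-trans (ℕ.≤-reflexive (symbol-length _ _ eq)) (Split.left< (splitOf A))
  ... | there (here eq) = ℕ.≤-<-trans (ℕ.≤-reflexive (symbol-length _ _ eq)) (Split.right< (splitOf A))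

  ▷⁺-length : ∀ {A B} → TransClosure (rules ⊢_▷_) A B → length⁺ (wordOf B) < length⁺ (wordOf A)
  ▷⁺-length [ p ]    = ▷-length p
  ▷⁺-length (p ∷ ps) = ℕ.<-trans (▷⁺-length ps) (▷-length p)

  rules-acyclic : Acyclic rules
  rules-acyclic A p = ℕ.<-irrefl refl (▷⁺-length p)

  derive-symbol : ∀ w w∈ → (∀ A → length⁺ (wordOf A) ≡ length⁺ w → rules ⊢ rhs rules A ⇒ toList (wordOf A)) →
    ∀ {ss u} → rules ⊢ ss ⇒ u → rules ⊢ symbol w w∈ ∷ ss ⇒ toList w ++ u
  derive-symbol (a ∷ [])    w∈ ih d = terminal d
  derive-symbol (a ∷ b ∷ t) w∈ ih {ss} {u} d =
    subst (λ (v : Word k) → rules ⊢ inj₁ (index m) ∷ ss ⇒ toList v ++ u) (index-word m)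
      (nonterminal (ih (index m) (cong length⁺ (index-word m))) d)
    where m = w∈ (long a b t)

  derive : ∀ A → Acc _<_ (length⁺ (wordOf A)) → rules ⊢ rhs rules A ⇒ toList (wordOf A)
  derive A (acc rs) = subst (λ ss → rules ⊢ ss ⇒ toList (wordOf A)) (sym (rhs≡ A))
    (subst (rules ⊢ toList (rule A) ⇒_) (trans (cong (toList left ++_) (List.++-identityʳ (toList right))) left++right)
      (derive-symbol left _ (λ B eq → derive B (rs (ℕ.≤-<-trans (ℕ.≤-reflexive eq) left<)))
        (derive-symbol right _ (λ B eq → derive B (rs (ℕ.≤-<-trans (ℕ.≤-reflexive eq) right<))) done)))
    where open Split (splitOf A)

bisection : Compressor
bisection (a ∷ []) = 𝔸 , val-unique 𝔸 (terminal done)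
  where
  no-cycle : ∀ {A B} → ¬ TransClosure (λ A B → ((inj₂ a ∷ []) ∷ []) ⊢ A ▷ B) A B
  no-cycle {zero} [ here () ]
  no-cycle {zero} [ there () ]
  no-cycle {zero} (here () ∷ _)
  no-cycle {zero} (there () ∷ _)

  𝔸 : SLP _
  𝔸 = record { rules = (inj₂ a ∷ []) ∷ [] ; start = zero ; acyclic = λ _ → no-cycle }
bisection w@(a ∷ b ∷ t) = 𝔸 , trans (val-unique 𝔸 (derive (index w∈D) (<-wellFounded _))) (cong toList (sym (lookup-index w∈D)))
  where
  w∈D : w ∈ arisingDistinct w
  w∈D = ∈-deduplicate⁺ _≟ʷ_ (arising-head w (long a b t) (<-wellFounded (length⁺ w)))

  open BisectionGrammar (arisingDistinct w) (arisingDistinct-closed w)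

  𝔸 : SLP _
  𝔸 = record { rules = rules ; start = index w∈D ; acyclic = rules-acyclic }

private
  _≟ˢ_ : DecidableEquality (Symbol N k)
  _≟ˢ_ = Sum.≡-dec Fin._≟_ Fin._≟_

  module _ {N k} (R : Rules N k) where

    Walk : ℕ → Fin N → Set
    Walk zero    A = ⊤
    Walk (suc l) A = ∃ λ B → R ⊢ A ▷ B × Walk l B

    walk? : ∀ l A → Dec (Walk l A)
    walk? zero    A = yes tt
    walk? (suc l) A = Fin.any? λ B → DecMembership._∈?_ _≟ˢ_ (inj₁ B) (rhs R A) ×-dec walk? l B

    visit : ∀ l {A} → Walk l A → Fin (suc l) → Fin N
    visit l       {A} _           zero    = A
    visit (suc l)     (_ , _ , p) (suc i) = visit l p i

    visit-▷⁺ : ∀ l {A} (p : Walk l A) i j → i <ᶠ j → TransClosure (R ⊢_▷_) (visit l p i) (visit l p j)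
    visit-▷⁺ (suc l) (B , s , p) zero    (suc zero)    _         = [ s ]
    visit-▷⁺ (suc l) (B , s , p) zero    (suc (suc j)) _         = s ∷ visit-▷⁺ l p zero (suc j) z<s
    visit-▷⁺ (suc l) (B , s , p) (suc i) (suc j)       (s≤s i<j) = visit-▷⁺ l p i j i<j

    cycle⇒walk : ∀ l {A B} → TransClosure (R ⊢_▷_) A A → TransClosure (R ⊢_▷_) B A → Walk l B
    cycle⇒walk zero    c p       = tt
    cycle⇒walk (suc l) c [ s ]       = _ , s , cycle⇒walk l c c
    cycle⇒walk (suc l) c (s ∷ p)     = _ , s , cycle⇒walk l c p

    acyclic? : Dec (Acyclic R)
    acyclic? with Fin.any? (walk? N)
    ... | no ¬walk = yes λ A c → ¬walk (A , cycle⇒walk N c c)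
    ... | yes (A , p) with i , j , i<j , eq ← Fin.pigeonhole (ℕ.n<1+n N) (visit N p) =
      no λ acyclic → acyclic _ (subst (TransClosure (R ⊢_▷_) _) (sym eq) (visit-▷⁺ N p i j i<j))

  Searchable : {A : Set} → (A → Set) → Set₁
  Searchable {A} Q = {P : A → Set} → (∀ x → Dec (P x)) → Dec (∃ λ x → Q x × P x)

  search-symbol : {P : Symbol N k → Set} → (∀ x → Dec (P x)) → Dec (∃ P)
  search-symbol P? with Fin.any? (P? ∘ inj₁) | Fin.any? (P? ∘ inj₂)
  ... | yes (A , p) | _           = yes (inj₁ A , p)
  ... | no _        | yes (a , p) = yes (inj₂ a , p)
  ... | no ¬p       | no ¬q       = no λ { (inj₁ A , p) → ¬p (A , p) ; (inj₂ a , q) → ¬q (a , q) }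

  search-list : ∀ m → Searchable {List (Symbol N k)} λ l → length l ≤ m
  search-list m P? with P? []
  search-list m       P? | yes p = yes ([] , z≤n , p)
  search-list zero    P? | no ¬p = no λ { ([] , _ , p) → ¬p p }
  search-list (suc m) P? | no ¬p = map′
    (λ { (x , l , b , p) → x ∷ l , s≤s b , p })
    (λ { ([] , _ , p) → contradiction p ¬p ; (x ∷ l , s≤s b , p) → x , l , b , p })
    (search-symbol λ x → search-list m (P? ∘ (x ∷_)))

  search-list⁺ : ∀ m → Searchable {List⁺ (Symbol N k)} λ l → length⁺ l ≤ suc m
  search-list⁺ m P? = map′
    (λ { (x , l , b , p) → x ∷ l , s≤s b , p })
    (λ { (x ∷ l , s≤s b , p) → x , l , b , p })
    (search-symbol λ x → search-list m (P? ∘ (x ∷_)))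

  search-vec : ∀ m n → Searchable {Vec (List⁺ (Symbol N k)) n} λ v → rulesSize v ≤ m
  search-vec m zero P? = map′ (λ p → [] , z≤n , p) (λ { ([] , _ , p) → p }) (P? [])
  search-vec zero (suc n) P? = no λ { ((_ ∷ _) ∷ _ , () , _) }
  search-vec {N} {k} (suc m) (suc n) {P} P? = map′ to from
    (search-list⁺ m λ l → search-vec (suc m) n λ v → (length⁺ l + rulesSize v ≤? suc m) ×-dec P? (l ∷ v))
    where
    Nested : Set
    Nested = ∃ λ (l : List⁺ (Symbol N k)) → length⁺ l ≤ suc m × ∃ λ (v : Vec (List⁺ (Symbol N k)) n) →
      rulesSize v ≤ suc m × length⁺ l + rulesSize v ≤ suc m × P (l ∷ v)

    to : Nested → ∃ λ v → rulesSize v ≤ suc m × P v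
    to (l , _ , v , _ , b , p) = l ∷ v , b , p

    from : (∃ λ v → rulesSize v ≤ suc m × P v) → Nested
    from (l ∷ v , b , p) =
      l , ℕ.≤-trans (ℕ.m≤m+n _ _) b , v , ℕ.≤-trans (ℕ.m≤n+m _ (length⁺ l)) b , b , p

  N≤size : ∀ {n} (v : Vec (List⁺ (Symbol N k)) n) → n ≤ rulesSize v
  N≤size []      = z≤n
  N≤size (l ∷ v) = ℕ.+-mono-≤ (s≤s z≤n) (N≤size v)

0<size : (𝔸 : SLP k) → 0 < size 𝔸
0<size 𝔸 = ℕ.<-≤-trans (ℕ.≤-<-trans z≤n (Fin.toℕ<n (SLP.start 𝔸))) (N≤size (SLP.rules 𝔸))

ProducedWithSize : Word k → ℕ → Set
ProducedWithSize w m = ∃ λ 𝔸 → Produces 𝔸 w × size 𝔸 ≡ m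

producedWithSize? : (w : Word k) → ∀ m → Dec (ProducedWithSize w m)
producedWithSize? {k} w m = map′ to from
  (ℕ.anyUpTo? (λ N → search-vec m N (rules? N)) (suc m))
  where
  Good : ∀ N → Rules N k → Set
  Good N R = Σ[ c ∈ Acyclic R ] (∃ λ S → Produces (record { rules = R ; start = S ; acyclic = c }) w × rulesSize R ≡ m)

  rules? : ∀ N (R : Rules N k) → Dec (Good N R)
  rules? N R with acyclic? R
  ... | no ¬c = no (¬c ∘ proj₁)
  ... | yes c = map′ (c ,_)
    (λ { (c′ , S , p , s) → S , trans (val-unique 𝔸[ c , S ] (val-derives 𝔸[ c′ , S ])) p , s })
    (Fin.any? λ S → List.≡-dec Fin._≟_ (val 𝔸[ c , S ]) (toList w) ×-dec (rulesSize R ≟ m))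
    where
    𝔸[_,_] : Acyclic R → Fin N → SLP k
    𝔸[ c , S ] = record { rules = R ; start = S ; acyclic = c }

  to : (∃ λ N → N < suc m × ∃ λ R → rulesSize R ≤ m × Good N R) → ProducedWithSize w m
  to (N , _ , R , _ , c , S , p , s) = record { rules = R ; start = S ; acyclic = c } , p , s

  from : ProducedWithSize w m → ∃ λ N → N < suc m × ∃ λ R → rulesSize R ≤ m × Good N R
  from (𝔸 , p , refl) = SLP.#N 𝔸 , s≤s (N≤size (SLP.rules 𝔸)) , SLP.rules 𝔸 , ℕ.≤-refl ,
    SLP.acyclic 𝔸 , SLP.start 𝔸 , p , refl

IsLeast : (ℕ → Set) → ℕ → Set
IsLeast P m = P m × (∀ n → P n → m ≤ n)

least : {P : ℕ → Set} → (∀ n → Dec (P n)) → ∀ {n} → P n → ∃ (IsLeast P)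
least {P} P? {n} = go n (<-wellFounded n)
  where
  go : ∀ n → Acc _<_ n → P n → ∃ (IsLeast P)
  go n (acc rs) p with ℕ.anyUpTo? P? n
  ... | yes (m , m<n , q) = go m (rs m<n) q
  ... | no ¬q             = n , p , λ m q → ℕ.≮⇒≥ λ m<n → ¬q (m , m<n , q)

smallest : (w : Word k) → ∃ (IsLeast (ProducedWithSize w))
smallest w = least (producedWithSize? w) (proj₁ (bisection w) , proj₂ (bisection w) , refl)

g : Word k → ℕ
g w = proj₁ (smallest w)

g-isLeast : (w : Word k) → IsLeast (ProducedWithSize w) (g w)
g-isLeast w = proj₂ (smallest w)

g-nonZero : (w : Word k) → NonZero (g w)
g-nonZero w with 𝔸 , _ , eq ← proj₁ (g-isLeast w) = >-nonZero (subst (0 <_) eq (0<size 𝔸))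

lists : ∀ k → ℕ → List (List (Fin k))
lists k zero    = [] ∷ []
lists k (suc n) = cartesianProductWith _∷_ (allFin k) (lists k n)

words : ∀ k → ℕ → List (Word k)
words k zero    = []
words k (suc n) = cartesianProductWith _∷_ (allFin k) (lists k n)

ratio : Compressor → Word k → ℚ
ratio 𝒞 w = _/_ (ℤ.+ size (proj₁ (𝒞 w))) (g w) {{g-nonZero w}}

-- The seed 0ℚ of the maximum is irrelevant for k, n ≥ 1: the list is then
-- nonempty and all ratios are positive.
α : Compressor → ℕ → ℕ → ℚ
α 𝒞 k n = max (DecTotalOrder.totalOrder ℚ.≤-decTotalOrder) 0ℚ (mapᴸ (ratio 𝒞) (words k n))

-- The library has no reals.  A nonnegative real x is represented by the two
-- sets { q ∈ ℚ | q ≥ 0, q ≤ x } and { q ∈ ℚ | q ≥ 0, x ≤ q }, which determine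
-- it.  The definitions below are the exact descriptions of these sets.
-- Only nonnegative rationals are compared with such an x (via _≤ʳ_ and _ʳ≤_).
record ℝ⁺ : Set₁ where
  field
    Lower Upper : ℚ → Set

infix 4 _≤ʳ_ _ʳ≤_

_≤ʳ_ : ℚ → ℝ⁺ → Set
q ≤ʳ x = 0ℚ ≤ℚ q × ℝ⁺.Lower x q

_ʳ≤_ : ℝ⁺ → ℚ → Set
x ʳ≤ q = 0ℚ ≤ℚ q × ℝ⁺.Upper x q

-- Base 2; another base only changes the constants of an asymptotic bound.
-- For n ≥ 1 and p, d ∈ ℕ with d ≥ 1:  p / d ≤ log₂ n  iff  2 ^ p ≤ n ^ d.
log₂ : ℕ → ℝ⁺
log₂ n = record
  { Lower = λ q → 2 ^ ℤ.∣ ↥ q ∣ ≤ n ^ ↧ₙ q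
  ; Upper = λ q → n ^ ↧ₙ q ≤ 2 ^ ℤ.∣ ↥ q ∣
  }

infixl 7 _÷_ _·_

-- n / x for x > 0:  q ≤ n / x  iff  q s ≤ n for some s ≥ x;  dually for ≥.
_÷_ : ℕ → ℝ⁺ → ℝ⁺
n ÷ x = record
  { Lower = λ q → ∃ λ s → x ʳ≤ s × q *ℚ s ≤ℚ ℤ.+ n / 1
  ; Upper = λ q → ∃ λ s → s ≤ʳ x × ℤ.+ n / 1 ≤ℚ q *ℚ s
  }

√_ : ℝ⁺ → ℝ⁺
√ x = record
  { Lower = λ q → q *ℚ q ≤ʳ x
  ; Upper = λ q → x ʳ≤ q *ℚ q
  }

-- c · x for rational c > 0.
_·_ : ℚ → ℝ⁺ → ℝ⁺
c · x = record
  { Lower = λ q → ∃ λ s → s ≤ʳ x × q ≤ℚ c *ℚ s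
  ; Upper = λ q → ∃ λ s → x ʳ≤ s × c *ℚ s ≤ℚ q
  }

{-# OPTIONS --safe #-}

-- Upper bound.  Fix t = 2 ^ a.  Of the words arising in BISECTION, at most 2n / t
-- occurrences are longer than t.  A shorter one is a suffix of w or a factor of
-- length 2 ^ i ≤ t.  A factor of length l ≥ 2 straddles a boundary in some
-- right-hand side of a smallest grammar, so there are at most l · g(w) of them, and
-- 2 t g(w) over all i.  With t ≈ √(n / log n) and g(w) ≥ log₂ n, all contributions
-- are O(t g(w)).
--
-- Lower bound.  Let v be a word of odd length m P, with m ≈ log n and
-- P ≈ 2 ^ e / 2 ≈ √(n / log n), whose cyclic factors of length 2 ^ e are pairwise
-- different, and let w be the 2 ^ e-th power of v, padded to length n.  As |v| is
-- coprime to 2 ^ e, the aligned blocks of length 2 ^ e of w run through all m P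
-- cyclic factors of v, and BISECTION needs a nonterminal for each.  Taking v to be
-- the product of b b a^(1+i) b a^(P-4-i) for i < m, one has g(w) = O(log n).

module Submission where

open import Defs
open import Data.Fin using (Fin; zero; suc)
import Data.Fin.Properties as Fin
import Data.Integer as ℤ
import Data.Integer.Properties as ℤ
open import Data.List using (List; []; _∷_; _++_; length; map; take; drop; upTo; allFin; concat; concatMap; filter; applyUpTo; replicate)
open import Data.List.Membership.Propositional using (_∈_)
open import Data.List.Membership.Propositional.Properties
  using (∈-∃++; ∈-lookup; ∈-allFin; ∈-++⁺ˡ; ∈-++⁺ʳ; ∈-++⁻; ∈-map⁺; ∈-upTo⁺; ∈-concatMap⁺; ∈-filter⁺;
    ∈-deduplicate⁺; ∈-deduplicate⁻; ∈-cartesianProductWith⁺; ∈-cartesianProductWith⁻)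
import Data.List.Properties as List
open import Data.List.NonEmpty using (List⁺; _∷_; toList) renaming (length to length⁺)
open import Data.List.Relation.Binary.Permutation.Propositional using (_↭_)
open import Data.List.Relation.Binary.Permutation.Propositional.Properties using (shift; ∈-resp-↭) renaming (map⁺ to ↭-map⁺)
open import Data.List.Relation.Binary.Subset.Propositional using (_⊆_)
open import Data.List.Relation.Unary.All as All using (All; []; _∷_)
import Data.List.Relation.Unary.All.Properties as All
open import Data.List.Relation.Unary.AllPairs using ([]; _∷_)
open import Data.List.Relation.Unary.Any as Any using (here; there; index)
open import Data.List.Relation.Unary.Any.Properties using (lookup-index)
open import Data.List.Relation.Unary.Unique.DecPropositional.Properties using (deduplicate-!)
open import Data.List.Relation.Unary.Unique.Propositional using (Unique)
open import Data.Nat using (ℕ; zero; suc; _+_; _*_; _∸_; _^_; _≤_; z≤n; s≤s; z<s; s<s; _<?_; _≤?_; _/_; _%_; NonZero; >-nonZero) renaming (_<_ to _<ⁿ_)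
import Data.Nat.Coprimality as Coprimality
open import Data.Nat.DivMod using (m≡m%n+[m/n]*n; m%n<n; m<n⇒m%n≡m; m<n⇒m/n≡0; m*n/n≡m; [m+kn]%n≡m%n; +-distrib-/-∣ˡ; +-distrib-/-∣ʳ)
open import Data.Nat.Divisibility using (_∣_; divides; 0∣⇒≡0; ∣⇒≤; >⇒∤; ∣m+n∣m⇒∣n; ∣n⇒∣m*n; m∣m*n; n∣m*n)
open import Data.Nat.Induction using (<-wellFounded)
open import Data.Nat.ListAction using (sum)
open import Data.Nat.ListAction.Properties using (sum-↭)
import Data.Nat.Properties as ℕ
open import Data.Nat.Tactic.RingSolver using (solve-∀)
open import Data.Product using (∃; ∃₂; ∃-syntax; _×_; _,_; proj₁; proj₂)
open import Data.Rational using (ℚ; 0ℚ; _<_; toℚᵘ) renaming (_≤_ to _≤ℚ_; _/_ to _/ℚ_; _*_ to _*ℚ_)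
import Data.Rational.Properties as ℚ
open import Data.Rational.Unnormalised using (mkℚᵘ; *≤*)
import Data.Rational.Unnormalised as ℚᵘ
import Data.Rational.Unnormalised.Properties as ℚᵘ
open import Data.Sum using (_⊎_; inj₁; inj₂; [_,_]′)
open import Data.Vec using (Vec; []; _∷_; lookup)
import Data.Vec.Properties as Vec
open import Function using (_∘_)
open import Induction.WellFounded using (Acc; acc)
open import Relation.Binary.Bundles using (DecTotalOrder)
open import Relation.Binary.Construct.Closure.Transitive using (TransClosure; [_]; _∷_)
open import Relation.Binary.PropositionalEquality using (_≡_; _≢_; refl; sym; trans; cong; cong₂; subst; subst₂)
open import Relation.Nullary using (¬_; yes; no; contradiction)
open import Data.List.Extrema (DecTotalOrder.totalOrder ℚ.≤-decTotalOrder) using (⊥≤max; xs≤max; max≤v⁺)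

-- The length of a derived word

-- Neither bound depends on `k`: the upper one counts factors over any alphabet, and two letters
-- suffice for the hard words. Real logarithms are replaced by h, the integer part of log₄ n, so
-- that 2h ≤ log₂ n < 2h + 2; powers of two within a constant factor of √(n / log n) then serve as
-- the rational witnesses. Working in base 4 also makes m = 2h + 1, a number of order log n, odd at
-- no cost. The block length is P = 2^(e-1) - 1. It is odd, and it is the largest odd number with 2P
-- ≤ 2^e, the condition under which every window of length 2^e contains a whole block. So mP is odd,
-- hence coprime to 2^e. The obstacle is that v needs m different blocks while g(w) has to stay
-- O(log n). A constant number of rules per block is affordable because m is itself of order log n,
-- provided that the runs of `a` are generated once and shared by all blocks. BISECTION then has
-- size at least 2mP against O(m), a ratio of order P.

Unique⇒lookup-injective : ∀ {A : Set} {xs : List A} → Unique xs →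
  ∀ i j → Data.List.lookup xs i ≡ Data.List.lookup xs j → i ≡ j
Unique⇒lookup-injective (_ ∷ _) zero zero _ = refl
Unique⇒lookup-injective {xs = _ ∷ xs} (x∉ ∷ _) zero (suc j) eq = contradiction eq (All.lookup x∉ (∈-lookup {xs = xs} j))
Unique⇒lookup-injective {xs = _ ∷ xs} (x∉ ∷ _) (suc i) zero eq = contradiction (sym eq) (All.lookup x∉ (∈-lookup {xs = xs} i))
Unique⇒lookup-injective (_ ∷ u) (suc i) (suc j) eq = cong suc (Unique⇒lookup-injective u i j eq)

index-injective : ∀ {A : Set} {xs : List A} {x y} (p : x ∈ xs) (q : y ∈ xs) → index p ≡ index q → x ≡ y
index-injective {xs = xs} p q eq = trans (lookup-index p) (trans (cong (Data.List.lookup xs) eq) (sym (lookup-index q)))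

-- The upper count of distinct words goes through this. Repetitions in `ys` do no harm, so a cover
-- may be a crude list.
Unique-covered⇒length≤ : ∀ {A B : Set} (f : A → B) → (∀ {x y} → f x ≡ f y → x ≡ y) →
  ∀ {xs : List A} {ys : List B} → Unique xs → (∀ {x} → x ∈ xs → f x ∈ ys) → length xs ≤ length ys
Unique-covered⇒length≤ f f-inj {xs} u cover = Fin.injective⇒≤ {f = λ i → index (cover (∈-lookup {xs = xs} i))}
  λ {i} {j} eq → Unique⇒lookup-injective u i j (f-inj (index-injective (cover (∈-lookup i)) (cover (∈-lookup j)) eq))

n<2^n : ∀ n → n <ⁿ 2 ^ n
n<2^n zero    = z<s
n<2^n (suc n) = ℕ.+-mono-≤ (ℕ.m^n>0 2 n) (ℕ.≤-trans (n<2^n n) (ℕ.m≤m+n _ 0))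

module _ {N k} (R : Rules N k) where

  weight : List (Fin N) → ℕ
  weight L = sum (map (length⁺ ∘ lookup R) L)

  -- Along a path of an acyclic grammar no nonterminal repeats, so below a
  -- nonterminal A only the nonterminals of L other than A remain available.
  |derived|≤ : Acyclic R → ∀ L {ss w} → R ⊢ ss ⇒ w →
    (∀ {A} → inj₁ A ∈ ss → A ∈ L × (∀ {B} → TransClosure (R ⊢_▷_) A B → B ∈ L)) →
    length w ≤ length ss * 2 ^ weight L
  |derived|≤ acyclic L done         reach = z≤n
  |derived|≤ acyclic L (terminal d) reach =
    ℕ.+-mono-≤ (ℕ.m^n>0 2 (weight L)) (|derived|≤ acyclic L d (reach ∘ there))
  |derived|≤ acyclic L (nonterminal {A} {u = u} {w} d e) reach
    with A∈L , below ← reach (here refl)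
    with xs , ys , refl ← ∈-∃++ A∈L = begin
      length (u ++ w)                        ≡⟨ List.length-++ u ⟩
      length u + length w                    ≤⟨ ℕ.+-mono-≤ |u|≤ (|derived|≤ acyclic L e (reach ∘ there)) ⟩
      2 ^ weight L + _                       ∎
    where
    open ℕ.≤-Reasoning
    L∖A = xs ++ ys

    perm : L ↭ A ∷ L∖A
    perm = shift A xs ys

    survives : ∀ {B} → B ∈ L → A ≢ B → B ∈ L∖A
    survives B∈L A≢B with ∈-resp-↭ perm B∈L
    ... | here B≡A = contradiction (sym B≡A) A≢B
    ... | there B∈ = B∈

    reach′ : ∀ {B} → inj₁ B ∈ rhs R A → B ∈ L∖A × (∀ {C} → TransClosure (R ⊢_▷_) B C → C ∈ L∖A)
    reach′ B∈ = survives (below [ B∈ ]) (λ { refl → acyclic A [ B∈ ] }) ,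
      λ path → survives (below (B∈ ∷ path)) λ { refl → acyclic A (B∈ ∷ path) }

    |u|≤ : length u ≤ 2 ^ weight L
    |u|≤ = begin
      length u                                  ≤⟨ |derived|≤ acyclic L∖A d reach′ ⟩
      -- The estimate l ≤ 2^l turns the product of the right-hand side lengths into a power whose
      -- exponent is their sum.
      length⁺ (lookup R A) * 2 ^ weight L∖A     ≤⟨ ℕ.*-monoˡ-≤ _ (ℕ.<⇒≤ (n<2^n (length⁺ (lookup R A)))) ⟩
      2 ^ length⁺ (lookup R A) * 2 ^ weight L∖A ≡⟨ ℕ.^-distribˡ-+-* 2 (length⁺ (lookup R A)) (weight L∖A) ⟨
      2 ^ weight (A ∷ L∖A)                      ≡⟨ cong (2 ^_) (sum-↭ (↭-map⁺ _ perm)) ⟨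
      2 ^ weight L                              ∎

sum-lookup≡rulesSize : ∀ {N k m} (v : Vec (List⁺ (Symbol N k)) m) → sum (map (length⁺ ∘ lookup v) (allFin m)) ≡ rulesSize v
sum-lookup≡rulesSize []      = refl
sum-lookup≡rulesSize {m = suc m} (l ∷ v) = cong (length⁺ l +_) (trans
  (cong sum (trans (List.map-tabulate suc (length⁺ ∘ lookup (l ∷ v))) (sym (List.map-tabulate (λ i → i) (length⁺ ∘ lookup v)))))
  (sum-lookup≡rulesSize v))

|val|≤2^size : ∀ {k} (𝔸 : SLP k) → length (val 𝔸) ≤ 2 ^ size 𝔸
|val|≤2^size 𝔸 = begin
  length (val 𝔸)                    ≡⟨ cong length (List.++-identityʳ (val 𝔸)) ⟨
  length (val 𝔸 ++ [])              ≤⟨ |derived|≤ rules acyclic (allFin _) (nonterminal (val-derives 𝔸) done) (λ _ → ∈-allFin _ , λ _ → ∈-allFin _) ⟩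
  1 * 2 ^ weight rules (allFin _)   ≡⟨ ℕ.*-identityˡ _ ⟩
  2 ^ weight rules (allFin _)       ≡⟨ cong (2 ^_) (sum-lookup≡rulesSize rules) ⟩
  2 ^ size 𝔸                        ∎
  where
  open SLP 𝔸
  open ℕ.≤-Reasoning

n≤2^g : ∀ {k} (w : Word k) → length⁺ w ≤ 2 ^ g w
n≤2^g w with 𝔸 , prod , eq ← proj₁ (g-isLeast w) = subst₂ (λ v s → length v ≤ 2 ^ s) prod eq (|val|≤2^size 𝔸)

-- Factors of a derived word

factor : ∀ {A : Set} → ℕ → ℕ → List A → List A
factor l p w = take l (drop p w)

factor-++ˡ : ∀ {A : Set} l p (v w : List A) → p + l ≤ length v → factor l p (v ++ w) ≡ factor l p v
factor-++ˡ zero    zero    v       w _         = refl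
factor-++ˡ (suc l) zero    (a ∷ v) w (s≤s l≤v) = cong (a ∷_) (factor-++ˡ l zero v w l≤v)
factor-++ˡ l       (suc p) (a ∷ v) w (s≤s p≤v) = factor-++ˡ l p v w p≤v

factor-++ʳ : ∀ {A : Set} l p (v w : List A) → length v ≤ p → factor l p (v ++ w) ≡ factor l (p ∸ length v) w
factor-++ʳ l p       []      w _         = refl
factor-++ʳ l (suc p) (a ∷ v) w (s≤s v≤p) = factor-++ʳ l p v w v≤p

factor-++ : ∀ {A : Set} (x u y : List A) → factor (length u) (length x) (x ++ u ++ y) ≡ u
factor-++ []      []      y = refl
factor-++ []      (a ∷ u) y = cong (a ∷_) (factor-++ [] u y)
factor-++ (a ∷ x) u       y = factor-++ x u y

-- Here `s` is the number of letters left of the boundary. It starts at 0, and the position is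
-- truncated at 0, so that there are exactly `l` entries; the values of `s` without a true
-- straddling factor only enlarge the list.
straddling : ∀ {A : Set} → ℕ → List A → List A → List (List A)
straddling l v w = map (λ s → factor l (length v ∸ s) (v ++ w)) (upTo l)

∈-straddling : ∀ {A : Set} l p (v w : List A) → p <ⁿ length v → length v <ⁿ p + l → factor l p (v ++ w) ∈ straddling l v w
∈-straddling l p v w p<v v<p+l = subst (λ q → factor l q (v ++ w) ∈ straddling l v w) (ℕ.m∸[m∸n]≡n (ℕ.<⇒≤ p<v))
  (∈-map⁺ (λ s → factor l (length v ∸ s) (v ++ w)) (∈-upTo⁺ (ℕ.+-cancelˡ-< p _ _ (subst (_<ⁿ p + l) (sym (ℕ.m+[n∸m]≡n (ℕ.<⇒≤ p<v))) v<p+l))))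

module FactorCover {k} (𝔸 : SLP k) (l : ℕ) where
  open SLP 𝔸

  ⟦_⟧ : List (Symbol #N k) → List (Fin k)
  ⟦ ss ⟧ = proj₁ (⇒-totalString rules ss λ {B} _ → ⇒-total rules acyclic B)

  ⟦⟧≡ : ∀ {ss w} → rules ⊢ ss ⇒ w → ⟦ ss ⟧ ≡ w
  ⟦⟧≡ {ss} = ⇒-functional (proj₂ (⇒-totalString rules ss λ {B} _ → ⇒-total rules acyclic B))

  -- A boundary is placed after every symbol, the last one included, which makes the total length
  -- exactly `size 𝔸 * l`.
  stringCover : List (Symbol #N k) → List (List (Fin k))
  stringCover []       = []
  stringCover (X ∷ ss) = straddling l ⟦ X ∷ [] ⟧ ⟦ ss ⟧ ++ stringCover ss

  cover : List (List (Fin k))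
  cover = concatMap (stringCover ∘ rhs rules) (allFin #N)

  length-stringCover : ∀ ss → length (stringCover ss) ≡ length ss * l
  length-stringCover []       = refl
  length-stringCover (X ∷ ss) = trans (List.length-++ (straddling l ⟦ X ∷ [] ⟧ ⟦ ss ⟧))
    (cong₂ _+_ (trans (List.length-map _ (upTo l)) (List.length-upTo l)) (length-stringCover ss))

  length-concatMap-stringCover : ∀ L → length (concatMap (stringCover ∘ rhs rules) L) ≡ weight rules L * l
  length-concatMap-stringCover []      = refl
  length-concatMap-stringCover (A ∷ L) = trans (List.length-++ (stringCover (rhs rules A)))
    (trans (cong₂ _+_ (length-stringCover (rhs rules A)) (length-concatMap-stringCover L))
      (sym (ℕ.*-distribʳ-+ l (length (rhs rules A)) _)))

  length-cover : length cover ≡ size 𝔸 * l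
  length-cover = trans (length-concatMap-stringCover (allFin #N)) (cong (_* l) (sum-lookup≡rulesSize rules))

  rhs-cover : ∀ A {u} → u ∈ stringCover (rhs rules A) → u ∈ cover
  rhs-cover A u∈ = ∈-concatMap⁺ (stringCover ∘ rhs rules) {xs = allFin #N} (Any.map (λ { refl → u∈ }) (∈-allFin A))

  factor∈boundary : ∀ {X ss v w} → rules ⊢ X ∷ [] ⇒ v → rules ⊢ ss ⇒ w → ∀ p → p <ⁿ length v → length v <ⁿ p + l →
    factor l p (v ++ w) ∈ stringCover (X ∷ ss)
  factor∈boundary {v = v} {w} d e p p<v v<p+l rewrite ⟦⟧≡ d | ⟦⟧≡ e = ∈-++⁺ˡ (∈-straddling l p v w p<v v<p+l)

  -- Induction on the derivation: the factor lies inside the expansion of the first symbol, behind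
  -- it, or across the boundary between the two. `cov` records that the string at hand contributes
  -- to `cover`; descending into a nonterminal restarts it with `rhs-cover`. As `2 ≤ l`, the descent
  -- cannot end inside a single letter.
  factor∈cover′ : 2 ≤ l → ∀ {ss w} → rules ⊢ ss ⇒ w → (∀ {u} → u ∈ stringCover ss → u ∈ cover) →
    ∀ p → p + l ≤ length w → factor l p w ∈ cover
  factor∈cover′ 2≤l done cov p p≤ with () ← ℕ.≤-trans 2≤l (ℕ.≤-trans (ℕ.m≤n+m l p) p≤)
  factor∈cover′ 2≤l {inj₂ a ∷ ss} (terminal d) cov zero p≤ = cov (factor∈boundary (terminal done) d 0 z<s 2≤l)
  factor∈cover′ 2≤l {inj₂ a ∷ ss} (terminal d) cov (suc p) (s≤s p≤) =
    factor∈cover′ 2≤l d (cov ∘ ∈-++⁺ʳ (straddling l ⟦ inj₂ a ∷ [] ⟧ ⟦ ss ⟧)) p p≤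
  factor∈cover′ 2≤l {inj₁ A ∷ ss} (nonterminal {u = u} {w} d e) cov p p≤
    with p + l ≤? length u | length u ≤? p
  ... | yes p+l≤u | _ = subst (_∈ cover) (sym (factor-++ˡ l p u w p+l≤u)) (factor∈cover′ 2≤l d (rhs-cover A) p p+l≤u)
  ... | no _ | yes u≤p = subst (_∈ cover) (sym (factor-++ʳ l p u w u≤p))
        (factor∈cover′ 2≤l e (cov ∘ ∈-++⁺ʳ (straddling l ⟦ inj₁ A ∷ [] ⟧ ⟦ ss ⟧)) (p ∸ length u)
          (ℕ.+-cancelˡ-≤ (length u) _ _ (subst₂ _≤_ (trans (cong (_+ l) (sym (ℕ.m+[n∸m]≡n u≤p))) (ℕ.+-assoc (length u) _ l)) (List.length-++ u) p≤)))
  ... | no p+l≰u | no u≰p = cov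
        (factor∈boundary (subst (rules ⊢ inj₁ A ∷ [] ⇒_) (List.++-identityʳ u) (nonterminal d done)) e p
          (ℕ.≰⇒> u≰p) (ℕ.≰⇒> p+l≰u))

  factor∈cover : 2 ≤ l → ∀ p → p + l ≤ length (val 𝔸) → factor l p (val 𝔸) ∈ cover
  factor∈cover 2≤l = factor∈cover′ 2≤l (val-derives 𝔸) (rhs-cover start)

-- Words arising in BISECTION

2^-cancel-< : ∀ {i j} → 2 ^ i <ⁿ 2 ^ j → i <ⁿ j
2^-cancel-< 2^i<2^j = ℕ.≰⇒> λ j≤i → ℕ.<⇒≱ 2^i<2^j (ℕ.^-monoʳ-≤ 2 j≤i)

2^-cancel-≤ : ∀ {i j} → 2 ^ i ≤ 2 ^ j → i ≤ j
2^-cancel-≤ 2^i≤2^j = ℕ.≮⇒≥ λ j<i → ℕ.≤⇒≯ 2^i≤2^j (ℕ.^-monoʳ-< 2 (s<s z<s) j<i)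

module _ {k} {w : Word k} (s : Split w) where
  open Split s

  module _ {i} (|w|≡2^i : length⁺ w ≡ 2 ^ i) where

    split-power : i ≡ suc j
    split-power = ℕ.≤-antisym (2^-cancel-≤ {i} {suc j} (subst (_≤ 2 ^ suc j) |w|≡2^i |w|≤2^1+j))
                              (2^-cancel-< {j} {i} (subst (2 ^ j <ⁿ_) |w|≡2^i 2^j<|w|))

    |right|-power : length⁺ right ≡ 2 ^ j
    |right|-power = trans (ℕ.+-cancelˡ-≡ (2 ^ j) _ _
      (trans (cong (_+ length⁺ right) (sym |left|)) (trans |w|≡ (trans |w|≡2^i (cong (2 ^_) split-power)))))
      (ℕ.+-identityʳ (2 ^ j))

  2^≤left : ∀ {a} → 2 ^ a <ⁿ length⁺ w → 2 ^ a ≤ 2 ^ j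
  2^≤left {a} t<w = ℕ.^-monoʳ-≤ 2 (ℕ.m<1+n⇒m≤n (2^-cancel-< {a} {suc j} (ℕ.<-≤-trans t<w |w|≤2^1+j)))

  ++-left : ∀ (x u : List (Fin k)) {y} → toList left ≡ x ++ u ++ y → toList w ≡ x ++ u ++ (y ++ toList right)
  ++-left x u {y} eq = trans (sym left++right) (trans (cong (_++ toList right) eq)
    (trans (List.++-assoc x (u ++ y) _) (cong (x ++_) (List.++-assoc u y _))))

  ++-right : ∀ (x u : List (Fin k)) → toList right ≡ x ++ u → toList w ≡ (toList left ++ x) ++ u
  ++-right x u eq = trans (sym left++right) (trans (cong (toList left ++_) eq) (sym (List.++-assoc (toList left) x u)))

module _ {k : ℕ} where

  arising-∷ : ∀ (P : Word k → Set) (a b : Fin k) t (rs : ∀ {m} → m <ⁿ length⁺ (a ∷ b ∷ t) → Acc _<ⁿ_ m) → let open Split (split a b t) in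
    P (a ∷ b ∷ t) → (∀ {u} → u ∈ arising′ left (rs left<) → P u) → (∀ {u} → u ∈ arising′ right (rs right<) → P u) →
    ∀ {u} → u ∈ arising′ (a ∷ b ∷ t) (acc rs) → P u
  arising-∷ P a b t rs pw pl pr (here refl) = pw
  arising-∷ P a b t rs pw pl pr (there u∈) with ∈-++⁻ (arising′ (Split.left (split a b t)) _) u∈
  ... | inj₁ u∈ˡ = pl u∈ˡ
  ... | inj₂ u∈ʳ = pr u∈ʳ

  arising-infix : ∀ (w : Word k) ac {u} → u ∈ arising′ w ac → ∃₂ λ x y → toList w ≡ x ++ toList u ++ y
  arising-infix (a ∷ b ∷ t) (acc rs) = arising-∷ (λ u → ∃₂ λ x y → a ∷ b ∷ t ≡ x ++ toList u ++ y) a b t rs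
    ([] , [] , sym (List.++-identityʳ _))
    (λ {u} u∈ → let x , y , eq = arising-infix left _ u∈ in x , y ++ toList right , ++-left s x (toList u) eq)
    (λ {u} u∈ → let x , y , eq = arising-infix right _ u∈ in toList left ++ x , y , ++-right s x (toList u ++ y) eq)
    where
    s = split a b t
    open Split s

  arising-power : ∀ (w : Word k) ac i → length⁺ w ≡ 2 ^ i → ∀ {u} → u ∈ arising′ w ac → ∃ λ i → length⁺ u ≡ 2 ^ i
  arising-power (a ∷ b ∷ t) (acc rs) i |w| = arising-∷ (λ u → ∃ λ i → length⁺ u ≡ 2 ^ i) a b t rs (i , |w|)
    (arising-power left _ j |left|) (arising-power right _ j (|right|-power s {i} |w|))
    where
    s = split a b t
    open Split s

  -- Every left part has a power of two as its length, and so has everything that arises from it.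
  -- Other lengths occur only along the path of right parts, which consists of suffixes.
  arising-power⊎suffix : ∀ (w : Word k) ac {u} → u ∈ arising′ w ac →
    (∃ λ i → length⁺ u ≡ 2 ^ i) ⊎ (∃ λ x → toList w ≡ x ++ toList u)
  arising-power⊎suffix (a ∷ b ∷ t) (acc rs) = arising-∷
    (λ u → (∃ λ i → length⁺ u ≡ 2 ^ i) ⊎ (∃ λ x → a ∷ b ∷ t ≡ x ++ toList u)) a b t rs (inj₂ ([] , refl))
    (λ u∈ → inj₁ (arising-power left _ j |left| u∈))
    (λ u∈ → extend (arising-power⊎suffix right _ u∈))
    where
    s = split a b t
    open Split s
    extend : ∀ {u : Word k} → (∃ λ i → length⁺ u ≡ 2 ^ i) ⊎ (∃ λ x → toList right ≡ x ++ toList u) →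
      (∃ λ i → length⁺ u ≡ 2 ^ i) ⊎ (∃ λ x → a ∷ b ∷ t ≡ x ++ toList u)
    extend (inj₁ p)        = inj₁ p
    extend {u} (inj₂ (x , eq)) = inj₂ (toList left ++ x , ++-right s x (toList u) eq)

  arising-length≤ : ∀ (w : Word k) ac {u} → u ∈ arising′ w ac → length⁺ u ≤ length⁺ w
  arising-length≤ w ac {u} u∈ with x , y , eq ← arising-infix w ac u∈ =
    ℕ.≤-trans (List.length-++-≤ˡ (toList u)) (ℕ.≤-trans (List.length-++-≤ʳ (toList u ++ y) {x}) (ℕ.≤-reflexive (cong length (sym eq))))

  longer : ℕ → List (Word k) → List (Word k)
  longer t = filter (λ u → t <? length⁺ u)

  module _ {t : ℕ} where
    open ℕ.≤-Reasoning

    count-small : ∀ {F W} → F ≡ 0 → t ≤ W → suc F * t ≤ 2 * W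
    count-small refl t≤W = ℕ.*-mono-≤ {1} {2} (s≤s z≤n) t≤W

    count-powers : ∀ F₁ F₂ L R {F W} → F ≡ suc (F₁ + F₂) → L + R ≡ W → suc F₁ * t ≤ 2 * L → suc F₂ * t ≤ 2 * R → suc F * t ≤ 2 * W
    count-powers F₁ F₂ L R refl refl p q = begin
      suc (suc (F₁ + F₂)) * t      ≡⟨ rearrange F₁ F₂ t ⟩
      suc F₁ * t + suc F₂ * t      ≤⟨ ℕ.+-mono-≤ p q ⟩
      2 * L + 2 * R                ≡⟨ ℕ.*-distribˡ-+ 2 L R ⟨
      2 * (L + R)                  ∎
      where
      rearrange : ∀ x y z → suc (suc (x + y)) * z ≡ suc x * z + suc y * z
      rearrange = solve-∀

    count-power-left : ∀ F₁ F₂ L R {F W} → F ≡ suc (F₁ + F₂) → L + R ≡ W → suc F₁ * t ≤ 2 * L → F₂ * t ≤ 2 * R → F * t ≤ 2 * W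
    count-power-left F₁ F₂ L R refl refl p q = begin
      suc (F₁ + F₂) * t            ≡⟨ ℕ.*-distribʳ-+ t (suc F₁) F₂ ⟩
      suc F₁ * t + F₂ * t          ≤⟨ ℕ.+-mono-≤ p q ⟩
      2 * L + 2 * R                ≡⟨ ℕ.*-distribˡ-+ 2 L R ⟨
      2 * (L + R)                  ∎

  module _ (a : ℕ) where

    count : (w : Word k) → Acc _<ⁿ_ (length⁺ w) → ℕ
    count w ac = length (longer (2 ^ a) (arising′ w ac))

    long-count-small : ∀ w ac → length⁺ w ≤ 2 ^ a → count w ac ≡ 0
    long-count-small w ac w≤t = cong length (List.filter-none (λ u → 2 ^ a <? length⁺ u)
      (All.tabulate λ u∈ → ℕ.≤⇒≯ (ℕ.≤-trans (arising-length≤ w ac u∈) w≤t)))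

    long-count-∷ : ∀ x b t (rs : ∀ {m} → m <ⁿ length⁺ (x ∷ b ∷ t) → Acc _<ⁿ_ m) → let open Split (split x b t) in
      2 ^ a <ⁿ length⁺ (x ∷ b ∷ t) →
      count (x ∷ b ∷ t) (acc rs) ≡
      suc (count left (rs left<) + count right (rs right<))
    long-count-∷ x b t rs t<w = trans (cong length (List.filter-accept (λ u → 2 ^ a <? length⁺ u) t<w))
      (cong suc (trans (cong length (List.filter-++ _ (arising′ left (rs left<)) _)) (List.length-++ (longer (2 ^ a) (arising′ left (rs left<))))))
      where open Split (split x b t)

    -- The summand 2 ^ a gained for powers of two pays for the parent node; every
    -- left part is a power of two, so it is available in long-count below.
    long-count-power : ∀ w ac i → length⁺ w ≡ 2 ^ i → 2 ^ a ≤ length⁺ w →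
      suc (count w ac) * 2 ^ a ≤ 2 * length⁺ w
    long-count-power w@(_ ∷ []) ac i |w| t≤w = count-small (long-count-small w ac (ℕ.m^n>0 2 a)) t≤w
    long-count-power w@(x ∷ b ∷ t) ac@(acc rs) i |w| t≤w =
      [ (λ w≤t → count-small (long-count-small w ac w≤t) t≤w)
      , (λ t<w → count-powers (count left (rs left<)) (count right (rs right<)) (length⁺ left) (length⁺ right)
          (long-count-∷ x b t rs t<w) |w|≡
          (long-count-power left (rs left<) j |left| (half t<w |left|))
          (long-count-power right (rs right<) j (|right|-power s {i} |w|) (half t<w (|right|-power s {i} |w|))))
      ]′ (ℕ.≤-<-connex (length⁺ w) (2 ^ a))
      where
      s = split x b t
      open Split s
      half : ∀ {n} → 2 ^ a <ⁿ length⁺ w → n ≡ 2 ^ j → 2 ^ a ≤ n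
      half t<w refl = 2^≤left s {a} t<w

    -- The bound with `suc` does not extend to all words: a right part may be shorter than half of
    -- `2 ^ a`. The left part alone supplies the gain at each node of the suffix path.
    long-count : ∀ w ac → count w ac * 2 ^ a ≤ 2 * length⁺ w
    long-count (_ ∷ []) ac = z≤n
    long-count w@(x ∷ b ∷ t) ac@(acc rs) =
      [ (λ w≤t → subst (λ F → F * 2 ^ a ≤ 2 * length⁺ w) (sym (long-count-small w ac w≤t)) z≤n)
      , (λ t<w → count-power-left (count left (rs left<)) (count right (rs right<)) (length⁺ left) (length⁺ right)
          (long-count-∷ x b t rs t<w) |w|≡
          (long-count-power left (rs left<) j |left| (subst (2 ^ a ≤_) (sym |left|) (2^≤left s {a} t<w)))
          (long-count right (rs right<)))
      ]′ (ℕ.≤-<-connex (length⁺ w) (2 ^ a))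
      where
      s = split x b t
      open Split s

-- The upper bound on the size of the BISECTION grammar

toList-injective : ∀ {A : Set} {v w : List⁺ A} → toList v ≡ toList w → v ≡ w
toList-injective {v = _ ∷ _} {_ ∷ _} refl = refl

rulesSize-binary : ∀ {N k m} (f : Fin m → List⁺ (Symbol N k)) → (∀ i → length⁺ (f i) ≡ 2) → rulesSize (Data.Vec.tabulate f) ≡ m * 2
rulesSize-binary {m = zero}  f _  = refl
rulesSize-binary {m = suc m} f eq = cong₂ _+_ (eq zero) (rulesSize-binary (f ∘ suc) (eq ∘ suc))

size-bisection : ∀ {k} (w : Word k) → Long w → size (proj₁ (bisection w)) ≡ length (arisingDistinct w) * 2
size-bisection w (long a b t) = rulesSize-binary (BisectionGrammar.rule (arisingDistinct w) (arisingDistinct-closed w)) λ _ → refl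

module UpperBound {k} (w : Word k) (𝔸 : SLP k) (val≡ : Produces 𝔸 w) where

  -- Covers for the lengths 2, 4, ..., 2^a, whose sizes add up geometrically. Length 1 is left out
  -- because arising words have at least two letters.
  powerCover : ℕ → List (List (Fin k))
  powerCover zero    = []
  powerCover (suc a) = powerCover a ++ FactorCover.cover 𝔸 (2 ^ suc a)

  length-powerCover : ∀ a → length (powerCover a) ≤ size 𝔸 * 2 ^ suc a
  length-powerCover zero    = z≤n
  length-powerCover (suc a) = begin
    length (powerCover (suc a))                  ≡⟨ List.length-++ (powerCover a) ⟩
    length (powerCover a) + _                    ≤⟨ ℕ.+-mono-≤ (length-powerCover a) (ℕ.≤-reflexive (FactorCover.length-cover 𝔸 (2 ^ suc a))) ⟩
    size 𝔸 * 2 ^ suc a + size 𝔸 * 2 ^ suc a            ≡⟨ double (size 𝔸) (2 ^ suc a) ⟩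
    size 𝔸 * 2 ^ suc (suc a)                        ∎
    where
    open ℕ.≤-Reasoning
    double : ∀ x y → x * y + x * y ≡ x * (2 * y)
    double = solve-∀

  ∈-powerCover : ∀ a i → suc i ≤ a → ∀ {u} → u ∈ FactorCover.cover 𝔸 (2 ^ suc i) → u ∈ powerCover a
  ∈-powerCover (suc a) i (s≤s i≤a) u∈ with ℕ.m≤n⇒m<n∨m≡n i≤a
  ... | inj₁ i<a  = ∈-++⁺ˡ (∈-powerCover a i i<a u∈)
  ... | inj₂ refl = ∈-++⁺ʳ (powerCover a) u∈

  suffixes : ℕ → List (List (Fin k))
  suffixes t = map (λ d → drop (length⁺ w ∸ d) (toList w)) (upTo (suc t))

  ∈-suffixes : ∀ t x u → toList w ≡ x ++ u → length u ≤ t → u ∈ suffixes t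
  ∈-suffixes t x u eq u≤t = subst (_∈ suffixes t) drop≡ (∈-map⁺ (λ d → drop (length⁺ w ∸ d) (toList w)) (∈-upTo⁺ (s≤s u≤t)))
    where
    drop-++ : ∀ x → drop (length x) (x ++ u) ≡ u
    drop-++ []      = refl
    drop-++ (_ ∷ x) = drop-++ x
    drop≡ : drop (length⁺ w ∸ length u) (toList w) ≡ u
    drop≡ = trans (cong₂ drop (trans (cong (λ v → length v ∸ length u) eq)
      (trans (cong (_∸ length u) (List.length-++ x)) (ℕ.m+n∸n≡m (length x) (length u)))) eq) (drop-++ x)

  longWords : ℕ → List (Word k)
  longWords a = longer (2 ^ a) (arising w)

  arisingCover : ℕ → List (List (Fin k))
  arisingCover a = map toList (longWords a) ++ powerCover a ++ suffixes (2 ^ a)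

  ∈-arisingCover : ∀ a {u} → u ∈ arising w → toList u ∈ arisingCover a
  ∈-arisingCover a {u} u∈ =
    [ shorter
    , (λ t<u → ∈-++⁺ˡ (∈-map⁺ toList (∈-filter⁺ (λ u → 2 ^ a <? length⁺ u) u∈ t<u)))
    ]′ (ℕ.≤-<-connex (length⁺ u) (2 ^ a))
    where
    shorter : length⁺ u ≤ 2 ^ a → toList u ∈ arisingCover a
    shorter u≤t with arising-power⊎suffix w _ u∈
    ... | inj₂ (x , eq) = ∈-++⁺ʳ (map toList (longWords a)) (∈-++⁺ʳ (powerCover a) (∈-suffixes (2 ^ a) x (toList u) eq u≤t))
    ... | inj₁ (zero , |u|≡) with long _ _ _ ← proj₁ (arising-closed w _ u∈) with () ← |u|≡
    ... | inj₁ (suc i , |u|≡) with x , y , eq ← arising-infix w _ u∈ =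
      ∈-++⁺ʳ (map toList (longWords a)) (∈-++⁺ˡ (∈-powerCover a i (2^-cancel-≤ {suc i} {a} (subst (_≤ 2 ^ a) |u|≡ u≤t))
        (subst (_∈ cover) (trans (cong (λ l → factor l (length x) (val 𝔸)) (sym |u|≡)) (trans (cong (factor _ (length x)) val≡xuy) (factor-++ x (toList u) y)))
          (factor∈cover (ℕ.*-monoʳ-≤ 2 (ℕ.m^n>0 2 i)) (length x)
            (subst₂ _≤_ (cong (length x +_) |u|≡) (sym (trans (cong length val≡xuy) (trans (List.length-++ x) (cong (length x +_) (List.length-++ (toList u))))))
              (ℕ.+-monoʳ-≤ (length x) (ℕ.m≤m+n (length⁺ u) (length y))))))))
      where
      open FactorCover 𝔸 (2 ^ suc i)
      val≡xuy = trans val≡ eq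

  length-arisingDistinct≤ : ∀ a → length (arisingDistinct w) ≤ length (longWords a) + (size 𝔸 * 2 ^ suc a + suc (2 ^ a))
  length-arisingDistinct≤ a = begin
    length (arisingDistinct w)
      ≤⟨ Unique-covered⇒length≤ toList toList-injective (deduplicate-! _≟ʷ_ (arising w)) (λ u∈ → ∈-arisingCover a (∈-deduplicate⁻ _≟ʷ_ (arising w) u∈)) ⟩
    length (arisingCover a)
      ≡⟨ trans (List.length-++ (map toList (longWords a))) (cong₂ _+_ (List.length-map toList (longWords a)) (List.length-++ (powerCover a))) ⟩
    length (longWords a) + (length (powerCover a) + length (suffixes (2 ^ a)))
      ≤⟨ ℕ.+-monoʳ-≤ (length (longWords a)) (ℕ.+-mono-≤ (length-powerCover a) (ℕ.≤-reflexive (trans (List.length-map _ (upTo (suc (2 ^ a)))) (List.length-upTo _)))) ⟩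
    length (longWords a) + (size 𝔸 * 2 ^ suc a + suc (2 ^ a)) ∎
    where open ℕ.≤-Reasoning

  -- With t = 2^a, the hypothesis makes 2n / t at most 16 t |𝔸|. The factors of length a power of
  -- two add 2 t |𝔸|, and the 1 + t suffixes add at most another 2 t |𝔸|.
  length-arisingDistinct≤′ : ∀ a → length⁺ w ≤ 8 * (2 ^ a * 2 ^ a * size 𝔸) → length (arisingDistinct w) ≤ 20 * (2 ^ a * size 𝔸)
  length-arisingDistinct≤′ a n≤ = distinct
    where
    open ℕ.≤-Reasoning
    t = 2 ^ a
    1≤tg : 1 ≤ t * size 𝔸
    1≤tg = ℕ.*-mono-≤ (ℕ.m^n>0 2 a) (0<size 𝔸)

    longs : length (longWords a) ≤ 16 * (t * size 𝔸)
    longs = ℕ.*-cancelʳ-≤ _ _ t {{ℕ.m^n≢0 2 a}} (begin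
      length (longWords a) * t   ≤⟨ long-count a w (<-wellFounded (length⁺ w)) ⟩
      2 * length⁺ w              ≤⟨ ℕ.*-monoʳ-≤ 2 n≤ ⟩
      2 * (8 * (t * t * size 𝔸))    ≡⟨ eq t (size 𝔸) ⟩
      16 * (t * size 𝔸) * t         ∎)
      where
      eq : ∀ x y → 2 * (8 * (x * x * y)) ≡ 16 * (x * y) * x
      eq = solve-∀

    distinct : length (arisingDistinct w) ≤ 20 * (t * size 𝔸)
    distinct = begin
      length (arisingDistinct w)                               ≤⟨ length-arisingDistinct≤ a ⟩
      length (longWords a) + (size 𝔸 * (2 * t) + (1 + t))
        ≤⟨ ℕ.+-mono-≤ longs (ℕ.+-monoʳ-≤ (size 𝔸 * (2 * t)) (ℕ.+-mono-≤ 1≤tg (ℕ.m≤m*n t (size 𝔸) {{>-nonZero (0<size 𝔸)}}))) ⟩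
      16 * (t * size 𝔸) + (size 𝔸 * (2 * t) + (t * size 𝔸 + t * size 𝔸))   ≡⟨ eq t (size 𝔸) ⟩
      20 * (t * size 𝔸)                                           ∎
      where
      eq : ∀ x y → 16 * (x * y) + (y * (2 * x) + (x * y + x * y)) ≡ 20 * (x * y)
      eq = solve-∀

bisection-size≤ : ∀ {k} (w : Word k) a {G} → ProducedWithSize w G → length⁺ w ≤ 8 * (2 ^ a * 2 ^ a * G) →
  size (proj₁ (bisection w)) ≤ 40 * (2 ^ a * G)
bisection-size≤ (_ ∷ [])      a (𝔸 , _ , refl)    n≤ = ℕ.≤-trans (ℕ.*-mono-≤ (ℕ.m^n>0 2 a) (0<size 𝔸)) (ℕ.m≤n*m _ 40)
bisection-size≤ w@(x ∷ y ∷ s) a (𝔸 , prod , refl) n≤ = begin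
  size (proj₁ (bisection w))       ≡⟨ size-bisection w (long x y s) ⟩
  length (arisingDistinct w) * 2   ≤⟨ ℕ.*-monoˡ-≤ 2 (UpperBound.length-arisingDistinct≤′ w 𝔸 prod a n≤) ⟩
  20 * (2 ^ a * size 𝔸) * 2        ≡⟨ ℕ.*-comm (20 * (2 ^ a * size 𝔸)) 2 ⟩
  2 * (20 * (2 ^ a * size 𝔸))      ≡⟨ ℕ.*-assoc 2 20 (2 ^ a * size 𝔸) ⟨
  40 * (2 ^ a * size 𝔸)            ∎
  where open ℕ.≤-Reasoning

-- Grammars given by lists of words

-- A list of words closed under factorization is a grammar with one binary rule
-- per word; since both factors are shorter, it is acyclic in whatever order.
data Avail {k} (D : List (List (Fin k))) : List (Fin k) → Set where
  empty  : Avail D []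
  letter : ∀ a → Avail D (a ∷ [])
  member : ∀ {u} → u ∈ D → Avail D u

Avail-mono : ∀ {k} {D D′ : List (List (Fin k))} → D ⊆ D′ → ∀ {u} → Avail D u → Avail D′ u
Avail-mono D⊆D′ empty      = empty
Avail-mono D⊆D′ (letter a) = letter a
Avail-mono D⊆D′ (member p) = member (D⊆D′ p)

record Factorization {k} (D : List (List (Fin k))) (w : List (Fin k)) : Set where
  field
    left right  : List (Fin k)
    left-avail  : Avail D left
    right-avail : Avail D right
    0<left      : 0 <ⁿ length left
    0<right     : 0 <ⁿ length right
    left++right : left ++ right ≡ w

  left< : length left <ⁿ length w
  left< = subst (length left <ⁿ_) (trans (sym (List.length-++ left)) (cong length left++right)) (ℕ.m<m+n _ 0<right)

  right< : length right <ⁿ length w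
  right< = subst (length right <ⁿ_) (trans (sym (List.length-++ left)) (cong length left++right)) (ℕ.m<n+m _ 0<left)

Factorable : ∀ {k} → List (List (Fin k)) → Set
Factorable D = ∀ {w} → w ∈ D → Factorization D w

Factorization-mono : ∀ {k} {D D′ : List (List (Fin k))} → D ⊆ D′ → ∀ {w} → Factorization D w → Factorization D′ w
Factorization-mono D⊆D′ φ = record
  { left-avail = Avail-mono D⊆D′ left-avail ; right-avail = Avail-mono D⊆D′ right-avail
  ; 0<left = 0<left ; 0<right = 0<right ; left++right = left++right }
  where open Factorization φ

module FactorGrammar {k} (D : List (List (Fin k))) (factorable : Factorable D) where

  wordOf : Fin (length D) → List (Fin k)
  wordOf = Data.List.lookup D

  symbol : ∀ {u} → Avail D u → 0 <ⁿ length u → Symbol (length D) k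
  symbol (letter a) _ = inj₂ a
  symbol (member p) _ = inj₁ (index p)

  factorization : ∀ A → Factorization D (wordOf A)
  factorization A = factorable (∈-lookup A)

  rule : Fin (length D) → List⁺ (Symbol (length D) k)
  rule A = symbol left-avail 0<left ∷ symbol right-avail 0<right ∷ []
    where open Factorization (factorization A)

  rules : Rules (length D) k
  rules = Data.Vec.tabulate rule

  rhs≡ : ∀ A → rhs rules A ≡ toList (rule A)
  rhs≡ A = cong toList (Vec.lookup∘tabulate rule A)

  symbol-length : ∀ {u} (av : Avail D u) 0<u {B} → inj₁ B ≡ symbol av 0<u → length (wordOf B) ≡ length u
  symbol-length (member p) _ refl = cong length (sym (lookup-index p))

  ▷-length : ∀ {A B} → rules ⊢ A ▷ B → length (wordOf B) <ⁿ length (wordOf A)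
  ▷-length {A} {B} p with subst (inj₁ B ∈_) (rhs≡ A) p
  ... | here eq         = ℕ.≤-<-trans (ℕ.≤-reflexive (symbol-length left-avail 0<left eq)) left<
    where open Factorization (factorization A)
  ... | there (here eq) = ℕ.≤-<-trans (ℕ.≤-reflexive (symbol-length right-avail 0<right eq)) right<
    where open Factorization (factorization A)

  ▷⁺-length : ∀ {A B} → TransClosure (rules ⊢_▷_) A B → length (wordOf B) <ⁿ length (wordOf A)
  ▷⁺-length [ p ]    = ▷-length p
  ▷⁺-length (p ∷ ps) = ℕ.<-trans (▷⁺-length ps) (▷-length p)

  derive-symbol : ∀ {u} (av : Avail D u) 0<u → (∀ A → length (wordOf A) ≡ length u → rules ⊢ rhs rules A ⇒ wordOf A) →
    ∀ {ss v} → rules ⊢ ss ⇒ v → rules ⊢ symbol av 0<u ∷ ss ⇒ u ++ v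
  derive-symbol (letter a) _ ih d = terminal d
  derive-symbol (member p) _ ih {ss} {v} d =
    subst (λ u → rules ⊢ inj₁ (index p) ∷ ss ⇒ u ++ v) (sym (lookup-index p))
      (nonterminal (ih (index p) (cong length (sym (lookup-index p)))) d)

  derive : ∀ A → Acc _<ⁿ_ (length (wordOf A)) → rules ⊢ rhs rules A ⇒ wordOf A
  derive A (acc rs) = subst (λ ss → rules ⊢ ss ⇒ wordOf A) (sym (rhs≡ A))
    (subst (rules ⊢ toList (rule A) ⇒_) (trans (cong (left ++_) (List.++-identityʳ right)) left++right)
      (derive-symbol left-avail 0<left (λ B eq → derive B (rs (ℕ.≤-<-trans (ℕ.≤-reflexive eq) left<)))
        (derive-symbol right-avail 0<right (λ B eq → derive B (rs (ℕ.≤-<-trans (ℕ.≤-reflexive eq) right<))) done)))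
    where open Factorization (factorization A)

  slp : Fin (length D) → SLP k
  slp A = record { rules = rules ; start = A ; acyclic = λ _ p → ℕ.<-irrefl refl (▷⁺-length p) }

  val-slp : ∀ A → val (slp A) ≡ wordOf A
  val-slp A = val-unique (slp A) (derive A (<-wellFounded _))

  size-slp : ∀ A → size (slp A) ≡ length D * 2
  size-slp A = rulesSize-binary rule λ _ → refl

g≤ : ∀ {k} (w : Word k) D → Factorable D → toList w ∈ D → g w ≤ length D * 2
g≤ w D factorable w∈D = proj₂ (g-isLeast w) (length D * 2)
  (slp (index w∈D) , trans (val-slp (index w∈D)) (sym (lookup-index w∈D)) , size-slp (index w∈D))
  where open FactorGrammar D factorable

-- An empty operand adds no rule, which keeps both sides of every factorization nonempty. Otherwise
-- the new word is put in front even if it occurs in `D` already: each position has its own rule.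
Factorable-++ : ∀ {k} {D : List (List (Fin k))} → Factorable D → ∀ {u v} → Avail D u → Avail D v →
  ∃ λ D′ → Factorable D′ × D ⊆ D′ × Avail D′ (u ++ v) × length D′ ≤ suc (length D)
Factorable-++ {D = D} f {[]}    {v}     au av = D , f , (λ p → p) , av , ℕ.n≤1+n _
Factorable-++ {D = D} f {u}     {[]}    au av = D , f , (λ p → p) , subst (Avail D) (sym (List.++-identityʳ u)) au , ℕ.n≤1+n _
Factorable-++ {D = D} f {a ∷ u} {b ∷ v} au av = D′ , factorable , there , member (here refl) , ℕ.≤-refl
  where
  D′ = (a ∷ u ++ b ∷ v) ∷ D
  factorable : Factorable D′
  factorable (here refl) = record
    { left-avail = Avail-mono there au ; right-avail = Avail-mono there av
    ; 0<left = z<s ; 0<right = z<s ; left++right = refl }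
  factorable (there p)   = Factorization-mono there (f p)

Factorable-concat : ∀ {k} {D : List (List (Fin k))} → Factorable D → ∀ {us} → All (Avail D) us →
  ∃ λ D′ → Factorable D′ × D ⊆ D′ × Avail D′ (concat us) × length D′ ≤ length us + length D
Factorable-concat {D = D} f []         = D , f , (λ p → p) , empty , ℕ.≤-refl
Factorable-concat {D = D} f (au ∷ aus)
  with D₁ , f₁ , D⊆D₁ , av , n₁ ← Factorable-concat f aus
  with D₂ , f₂ , D₁⊆D₂ , auv , n₂ ← Factorable-++ f₁ (Avail-mono D⊆D₁ au) av =
  D₂ , f₂ , (λ p → D₁⊆D₂ (D⊆D₁ p)) , auv , ℕ.≤-trans n₂ (s≤s n₁)

module _ {k : ℕ} where

  -- Every word satisfying T is available in some grammar with c binary rules.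
  Gen : ℕ → (List (Fin k) → Set) → Set
  Gen c T = ∃ λ D → Factorable D × (∀ {u} → T u → Avail D u) × length D ≤ c

  -- The empty word and single letters cost no rule, so a specification `T` need not list them.
  data From (T : List (Fin k) → Set) : List (Fin k) → Set where
    base   : ∀ {u} → T u → From T u
    empty  : From T []
    letter : ∀ a → From T (a ∷ [])

  gen-weaken : ∀ {c d T T′} → c ≤ d → (∀ {u} → T′ u → From T u) → Gen c T → Gen d T′
  gen-weaken {T = T} c≤d T′⇒T (D , f , have , n) = D , f , (λ t → from (T′⇒T t)) , ℕ.≤-trans n c≤d
    where
    from : ∀ {u} → From T u → Avail D u
    from (base t)   = have t
    from empty      = empty
    from (letter a) = letter a

  gen-concat : ∀ {c T} us → All (From T) us → Gen c T → Gen (length us + c) (λ u → T u ⊎ u ≡ concat us)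
  gen-concat {T = T} us aus gen with D , f , have , n ← gen-weaken {T′ = From T} ℕ.≤-refl (λ t → t) gen
    with D′ , f′ , D⊆D′ , av , n′ ← Factorable-concat f (All.map have aus) =
    D′ , f′ , (λ { (inj₁ t) → Avail-mono D⊆D′ (have (base t)) ; (inj₂ refl) → av }) , ℕ.≤-trans n′ (ℕ.+-monoʳ-≤ (length us) n)

  long-member : ∀ {D} {w : Word k} → Long w → Avail D (toList w) → toList w ∈ D
  long-member (long _ _ _) (member p) = p

  gen⇒g≤ : ∀ {c T} (w : Word k) → Long w → T (toList w) → Gen c T → g w ≤ c * 2
  gen⇒g≤ w l Tw (D , f , have , n) = ℕ.≤-trans (g≤ w D f (long-member l (have Tw))) (ℕ.*-monoˡ-≤ 2 n)

  halve : ∀ r → ∃ λ q → r ≡ q + q ⊎ r ≡ suc (q + q)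
  halve zero    = 0 , inj₁ refl
  halve (suc r) with halve r
  ... | q , inj₁ refl = q , inj₂ refl
  ... | q , inj₂ refl = suc q , inj₁ (cong suc (sym (ℕ.+-suc q q)))

  q<2^ : ∀ q e → q + q <ⁿ 2 ^ suc e → q <ⁿ 2 ^ e
  q<2^ q e lt = ℕ.*-cancelˡ-< 2 q (2 ^ e) (subst (_<ⁿ 2 ^ suc e) (cong (q +_) (sym (ℕ.+-identityʳ q))) lt)

  replicate-+ : ∀ p q (a : Fin k) → replicate p a ++ replicate q a ≡ replicate (p + q) a
  replicate-+ zero    q a = refl
  replicate-+ (suc p) q a = cong (a ∷_) (replicate-+ p q a)

  -- Binary expansion of `r`: each halving concatenates at most three words.
  gen-replicate : ∀ {c T} a e r → r <ⁿ 2 ^ e → Gen c T → Gen (3 * e + c) (λ u → T u ⊎ u ≡ replicate r a)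
  gen-replicate a zero    zero _ = gen-weaken ℕ.≤-refl λ { (inj₁ t) → base t ; (inj₂ refl) → empty }
  gen-replicate a zero    (suc r) (s≤s ())
  gen-replicate {c} {T} a (suc e) r r< gen with halve r
  ... | q , inj₁ refl = gen-weaken (subst (2 + (3 * e + c) ≤_) (eq e c) (ℕ.n≤1+n _))
        (λ { (inj₁ t) → base (inj₁ (inj₁ t)) 
           ; (inj₂ refl) → base (inj₂ (trans (sym (replicate-+ q q a)) (cong (replicate q a ++_) (sym (List.++-identityʳ _))))) })
        (gen-concat (replicate q a ∷ replicate q a ∷ []) (base (inj₂ refl) ∷ base (inj₂ refl) ∷ [])
          (gen-replicate a e q (q<2^ q e r<) gen))
    where
    eq : ∀ e c → 3 + (3 * e + c) ≡ 3 * suc e + c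
    eq = solve-∀
  ... | q , inj₂ refl = gen-weaken (ℕ.≤-reflexive (eq e c))
        (λ { (inj₁ t) → base (inj₁ (inj₁ t)) 
           ; (inj₂ refl) → base (inj₂ (cong (a ∷_) (trans (sym (replicate-+ q q a)) (cong (replicate q a ++_) (sym (List.++-identityʳ _)))))) })
        (gen-concat ((a ∷ []) ∷ replicate q a ∷ replicate q a ∷ []) (letter a ∷ base (inj₂ refl) ∷ base (inj₂ refl) ∷ [])
          (gen-replicate a e q (q<2^ q e (ℕ.<-trans (ℕ.n<1+n _) r<)) gen))
    where
    eq : ∀ e c → 3 + (3 * e + c) ≡ 3 * suc e + c
    eq = solve-∀

  -- Each run comes from its predecessor. Generating the runs separately by halving would cost a
  -- further logarithmic factor.
  gen-runs : ∀ a m → Gen (2 * m) (λ u → ∃ λ j → j ≤ m × u ≡ replicate j a)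
  gen-runs a zero    = [] , (λ ()) , (λ { (zero , _ , refl) → empty }) , z≤n
  gen-runs a (suc m) = gen-weaken (ℕ.≤-reflexive (eq m)) runs
    (gen-concat ((a ∷ []) ∷ replicate m a ∷ []) (letter a ∷ base (m , ℕ.≤-refl , refl) ∷ []) (gen-runs a m))
    where
    eq : ∀ m → 2 + 2 * m ≡ 2 * suc m
    eq = solve-∀
    runs : ∀ {u} → (∃ λ j → j ≤ suc m × u ≡ replicate j a) → From _ u
    runs (j , j≤ , refl) with ℕ.m≤n⇒m<n∨m≡n j≤
    ... | inj₁ (s≤s j≤m) = base (inj₁ (j , j≤m , refl))
    ... | inj₂ refl      = base (inj₂ (cong (a ∷_) (sym (List.++-identityʳ _))))

  doubling : ℕ → List (Fin k) → List (Fin k)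
  doubling zero    v = v
  doubling (suc e) v = doubling e v ++ doubling e v

  gen-doubling : ∀ {c T} v e → T v → Gen c T → Gen (2 * e + c) (_≡ doubling e v)
  gen-doubling v zero    Tv = gen-weaken ℕ.≤-refl λ { refl → base Tv }
  gen-doubling {c} v (suc e) Tv gen = gen-weaken (ℕ.≤-reflexive (eq e c)) (λ { refl → base (inj₂ (cong (doubling e v ++_) (sym (List.++-identityʳ _)))) })
    (gen-concat (doubling e v ∷ doubling e v ∷ []) (base refl ∷ base refl ∷ []) (gen-doubling v e Tv gen))
    where
    eq : ∀ e c → 2 + (2 * e + c) ≡ 2 * suc e + c
    eq = solve-∀

-- A periodic word with many aligned factors

applyUpTo-cong : ∀ {A : Set} {f f′ : ℕ → A} n → (∀ {i} → i <ⁿ n → f i ≡ f′ i) → applyUpTo f n ≡ applyUpTo f′ n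
applyUpTo-cong zero    eq = refl
applyUpTo-cong (suc n) eq = cong₂ _∷_ (eq z<s) (applyUpTo-cong n (λ i<n → eq (s<s i<n)))

applyUpTo-cancel : ∀ {A : Set} {f f′ : ℕ → A} n → applyUpTo f n ≡ applyUpTo f′ n → ∀ {i} → i <ⁿ n → f i ≡ f′ i
applyUpTo-cancel (suc n) eq {zero}  _         = List.∷-injectiveˡ eq
applyUpTo-cancel (suc n) eq {suc i} (s≤s i<n) = applyUpTo-cancel n (List.∷-injectiveʳ eq) i<n

applyUpTo-+ : ∀ {A : Set} (f : ℕ → A) m n → applyUpTo f (m + n) ≡ applyUpTo f m ++ applyUpTo (λ i → f (m + i)) n
applyUpTo-+ f zero    n = refl
applyUpTo-+ f (suc m) n = cong (f 0 ∷_) (applyUpTo-+ (λ i → f (suc i)) m n)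

factor-applyUpTo : ∀ {A : Set} (f : ℕ → A) l p n → p + l ≤ n → factor l p (applyUpTo f n) ≡ applyUpTo (λ t → f (p + t)) l
factor-applyUpTo f zero    zero    n       _         = refl
factor-applyUpTo f (suc l) zero    (suc n) (s≤s l≤n) = cong (f 0 ∷_) (factor-applyUpTo (λ i → f (suc i)) l zero n l≤n)
factor-applyUpTo f l       (suc p) (suc n) (s≤s p≤n) = factor-applyUpTo (λ i → f (suc i)) l p n p≤n

at : ∀ {A : Set} → A → List A → ℕ → A
at d []       _       = d
at d (x ∷ xs) zero    = x
at d (x ∷ xs) (suc i) = at d xs i

applyUpTo-at : ∀ {A : Set} d (xs : List A) → applyUpTo (at d xs) (length xs) ≡ xs
applyUpTo-at d []       = refl
applyUpTo-at d (x ∷ xs) = cong (x ∷_) (applyUpTo-at d xs)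

at-replicate-++ : ∀ {A : Set} (d : A) n xs i → at d (replicate n d ++ xs) (n + i) ≡ at d xs i
at-replicate-++ d zero    xs i = refl
at-replicate-++ d (suc n) xs i = at-replicate-++ d n xs i

at-replicate-++⁻ : ∀ {A : Set} (d : A) {b} → d ≢ b → ∀ n xs i → at d (replicate n d ++ xs) i ≡ b → ∃ λ j → i ≡ n + j × at d xs j ≡ b
at-replicate-++⁻ d d≢b zero    xs i       eq = i , refl , eq
at-replicate-++⁻ d d≢b (suc n) xs zero    eq = contradiction eq d≢b
at-replicate-++⁻ d d≢b (suc n) xs (suc i) eq with j , refl , eq′ ← at-replicate-++⁻ d d≢b n xs i eq = j , refl , eq′

odd-cancel-2^ : ∀ {n} → ¬ 2 ∣ n → ∀ e {x} → n ∣ 2 ^ e * x → n ∣ x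
odd-cancel-2^ odd zero    {x} n∣ = subst (_ ∣_) (ℕ.+-identityʳ x) n∣
odd-cancel-2^ {n} odd (suc e) {x} n∣ = odd-cancel-2^ odd e (Coprimality.coprime-divisor coprime (subst (n ∣_) (ℕ.*-assoc 2 (2 ^ e) x) n∣))
  where
  coprime : Coprimality.Coprime n 2
  coprime {zero}                (_ , d∣2)   with () ← 0∣⇒≡0 d∣2
  coprime {suc zero}            _           = refl
  coprime {suc (suc zero)}      (2∣n , _)   = contradiction 2∣n odd
  coprime {suc (suc (suc _))}   (_ , d∣2)   with s≤s (s≤s ()) ← ∣⇒≤ d∣2

module PeriodicWord {k} (a b : Fin k) (a≢b : a ≢ b) (m′ pad : ℕ) where

  m = suc m′
  -- The 4 counts the three letters `b` and the `a` after `bb`; `m` is the sum of `i` and `m ∸ i`.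
  -- The free parameter `pad` brings P to its prescribed value.
  P = 4 + (m + pad)

  -- The prefix bb identifies the start of a block, the third b its number.
  block : ℕ → List (Fin k)
  block i = b ∷ b ∷ a ∷ replicate i a ++ b ∷ replicate (m ∸ i) a ++ replicate pad a

  length-block : ∀ i → i ≤ m → length (block i) ≡ P
  length-block i i≤m = cong (3 +_) (begin
    length (replicate i a ++ b ∷ replicate (m ∸ i) a ++ replicate pad a)  ≡⟨ List.length-++ (replicate i a) ⟩
    length (replicate i a) + suc (length (replicate (m ∸ i) a ++ replicate pad a))
      ≡⟨ cong (λ x → length (replicate i a) + suc x) (List.length-++ (replicate (m ∸ i) a)) ⟩
    length (replicate i a) + suc (length (replicate (m ∸ i) a) + length (replicate pad a))
      ≡⟨ cong₂ (λ x y → x + suc y) (List.length-replicate i) (cong₂ _+_ (List.length-replicate (m ∸ i)) (List.length-replicate pad)) ⟩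
    i + suc (m ∸ i + pad)    ≡⟨ ℕ.+-suc i _ ⟩
    suc (i + (m ∸ i + pad))  ≡⟨ cong suc (ℕ.+-assoc i (m ∸ i) pad) ⟨
    suc (i + (m ∸ i) + pad)  ≡⟨ cong (λ x → suc (x + pad)) (ℕ.m+[n∸m]≡n i≤m) ⟩
    suc (m + pad)            ∎)
    where open Relation.Binary.PropositionalEquality.≡-Reasoning

  -- The default of `at` is the filler `a`, so a position that reads `b` lies inside the block
  -- automatically.
  at-block⁻ : ∀ i r → at a (block i) r ≡ b → r ≡ 0 ⊎ r ≡ 1 ⊎ r ≡ 3 + i
  at-block⁻ i 0 _ = inj₁ refl
  at-block⁻ i 1 _ = inj₂ (inj₁ refl)
  at-block⁻ i 2 eq = contradiction eq a≢b
  at-block⁻ i (suc (suc (suc r))) eq with at-replicate-++⁻ a a≢b i _ r eq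
  ... | zero  , refl , _   = inj₂ (inj₂ (cong (3 +_) (ℕ.+-identityʳ i)))
  ... | suc j , _    , eq′ with j₂ , _ , eq″ ← at-replicate-++⁻ a a≢b (m ∸ i) _ j eq′
    with _ , _ , eq‴ ← at-replicate-++⁻ a a≢b pad [] j₂ (subst (λ xs → at a xs j₂ ≡ b) (sym (List.++-identityʳ (replicate pad a))) eq″) =
    contradiction eq‴ a≢b

  at-block : ∀ i → at a (block i) (3 + i) ≡ b
  at-block i = trans (cong (at a (replicate i a ++ _)) (sym (ℕ.+-identityʳ i))) (at-replicate-++ a i _ 0)

  marker-injective : ∀ i j → at a (block i) (3 + j) ≡ b → j ≡ i
  marker-injective i j eq with inj₂ (inj₂ refl) ← at-block⁻ i (3 + j) eq = refl

  -- The infinite repetition of the blocks 0, ..., m - 1. As a function it reduces windows that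
  -- cross block boundaries to arithmetic on positions.
  f : ℕ → Fin k
  f p = at a (block ((p / P) % m)) (p % P)

  f-block : ∀ q r → r <ⁿ P → f (q * P + r) ≡ at a (block (q % m)) r
  f-block q r r<P = cong₂ (λ x y → at a (block (x % m)) y) quot rem
    where
    rem : (q * P + r) % P ≡ r
    rem = trans (cong (_% P) (ℕ.+-comm (q * P) r)) (trans ([m+kn]%n≡m%n r q P) (m<n⇒m%n≡m r<P))
    quot : (q * P + r) / P ≡ q
    quot = trans (+-distrib-/-∣ˡ {q * P} r (n∣m*n q)) (trans (cong₂ _+_ (m*n/n≡m q P) (m<n⇒m/n≡0 r<P)) (ℕ.+-identityʳ q))

  f-periodic : ∀ c p → f (c * (m * P) + p) ≡ f p
  f-periodic c p = cong₂ (λ x y → at a (block x) y) quot rem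
    where
    shift≡ : c * (m * P) + p ≡ p + c * m * P
    shift≡ = trans (ℕ.+-comm _ p) (cong (p +_) (sym (ℕ.*-assoc c m P)))
    rem : (c * (m * P) + p) % P ≡ p % P
    rem = trans (cong (_% P) shift≡) ([m+kn]%n≡m%n p (c * m) P)
    quot : (c * (m * P) + p) / P % m ≡ p / P % m
    quot = trans (cong (λ x → x / P % m) shift≡)
      (trans (cong (_% m) (trans (+-distrib-/-∣ʳ p (n∣m*n (c * m))) (cong (p / P +_) (m*n/n≡m (c * m) P))))
        ([m+kn]%n≡m%n (p / P) c m))

  3+i<P∸1 : ∀ {i} → i <ⁿ m → suc (3 + i) <ⁿ P
  3+i<P∸1 i<m = s≤s (s≤s (s≤s (s≤s (ℕ.≤-trans i<m (ℕ.m≤m+n m pad)))))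

  -- The letters `b` at offsets 1 and 3 + i are followed by `a`. For the marker this rests on
  -- `3+i<P∸1`: it is never the last letter of its block, hence never adjacent to the next `bb`.
  bb⇒start : ∀ x → f x ≡ b → f (suc x) ≡ b → x % P ≡ 0
  bb⇒start x fx≡b fsx≡b = go (at-block⁻ i r fx≡b)
    where
    q = x / P
    r = x % P
    i = q % m
    next : suc r <ⁿ P → at a (block i) (suc r) ≡ b
    next sr<P = trans (sym (f-block q (suc r) sr<P)) (trans (cong f
      (trans (ℕ.+-suc (q * P) r) (cong suc (trans (ℕ.+-comm (q * P) r) (sym (m≡m%n+[m/n]*n x P)))))) fsx≡b)
    go : r ≡ 0 ⊎ r ≡ 1 ⊎ r ≡ 3 + i → r ≡ 0
    go (inj₁ r≡0) = r≡0
    go (inj₂ (inj₁ r≡1)) with at-block⁻ i (suc r) (next (subst (λ r → suc r <ⁿ P) (sym r≡1) (s≤s (s≤s (s≤s z≤n)))))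
    ... | inj₂ (inj₁ eq) with () ← trans (sym r≡1) (ℕ.suc-injective eq)
    ... | inj₂ (inj₂ eq) with () ← trans (sym r≡1) (ℕ.suc-injective eq)
    go (inj₂ (inj₂ r≡)) with at-block⁻ i (suc r) (next (subst (λ r → suc r <ⁿ P) (sym r≡) (3+i<P∸1 (m%n<n q m))))
    ... | inj₂ (inj₁ eq) with () ← trans (sym r≡) (ℕ.suc-injective eq)
    ... | inj₂ (inj₂ eq) = contradiction (trans eq (sym r≡)) ℕ.1+n≢n

  -- A window of length 2 P contains the start bb of some block together with
  -- the marker b at distance 3 + i from it, where i is the block number mod m.
  window-injective : ∀ p x l → 2 * P ≤ l → (∀ {t} → t <ⁿ l → f (p + t) ≡ f (p + x + t)) → m * P ∣ x
  -- From q′ P = q P + x and q ≡ q′ modulo m. Cancelling the common i P, rather than subtracting q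
  -- P, avoids truncated subtraction.
  window-injective p x l 2P≤l same = ∣m+n∣m⇒∣n {n = x}
      (divides (q′ / m) (ℕ.+-cancelˡ-≡ (i * P) _ _ (begin
        i * P + (q / m * (m * P) + x)   ≡⟨ regroup i (q / m) m P x ⟩
        (i + q / m * m) * P + x         ≡⟨ cong (λ z → z * P + x) (m≡m%n+[m/n]*n q m) ⟨
        q * P + x                       ≡⟨ q′P≡ ⟨
        q′ * P                          ≡⟨ cong (_* P) (m≡m%n+[m/n]*n q′ m) ⟩
        (q′ % m + q′ / m * m) * P       ≡⟨ cong (λ z → (z + q′ / m * m) * P) (sym i≡) ⟩
        (i + q′ / m * m) * P            ≡⟨ trans (ℕ.*-distribʳ-+ P i (q′ / m * m)) (cong (i * P +_) (ℕ.*-assoc (q′ / m) m P)) ⟩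
        i * P + q′ / m * (m * P)        ∎)))
      (n∣m*n (q / m))
    where
    open Relation.Binary.PropositionalEquality.≡-Reasoning
    -- Distance to the next block start strictly after `p`. It equals P when `p` is a start itself,
    -- and t + r < 2P still holds for r < P.
    t = P ∸ p % P
    q = suc (p / P)
    i = q % m

    regroup : ∀ i a m P x → i * P + (a * (m * P) + x) ≡ (i + a * m) * P + x
    regroup = solve-∀

    p+t≡qP : p + t ≡ q * P
    p+t≡qP = begin
      p + t                          ≡⟨ cong (_+ t) (m≡m%n+[m/n]*n p P) ⟩
      p % P + p / P * P + t          ≡⟨ swap (p % P) (p / P * P) t ⟩
      p % P + t + p / P * P          ≡⟨ cong (_+ p / P * P) (ℕ.m+[n∸m]≡n (ℕ.<⇒≤ (m%n<n p P))) ⟩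
      q * P                          ∎
      where
      swap : ∀ x y z → x + y + z ≡ x + z + y
      swap = solve-∀

    transfer : ∀ r → r <ⁿ P → at a (block i) r ≡ b → f (p + x + t + r) ≡ b
    transfer r r<P eq = begin
      f (p + x + t + r)       ≡⟨ cong f (ℕ.+-assoc (p + x) t r) ⟩
      f (p + x + (t + r))     ≡⟨ same (ℕ.<-≤-trans (ℕ.+-mono-≤-< (ℕ.m∸n≤m P (p % P)) r<P) (subst (_≤ l) (cong (P +_) (ℕ.+-identityʳ P)) 2P≤l)) ⟨
      f (p + (t + r))         ≡⟨ cong f (trans (sym (ℕ.+-assoc p t r)) (cong (_+ r) p+t≡qP)) ⟩
      f (q * P + r)           ≡⟨ f-block q r r<P ⟩
      at a (block i) r        ≡⟨ eq ⟩
      b                       ∎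

    y = p + x + t

    y%P≡0 : y % P ≡ 0
    y%P≡0 = bb⇒start y (trans (cong f (sym (ℕ.+-identityʳ y))) (transfer 0 z<s refl))
      (trans (cong f (sym (trans (ℕ.+-suc y 0) (cong suc (ℕ.+-identityʳ y))))) (transfer 1 (s≤s (s≤s z≤n)) refl))

    q′ = y / P

    y≡q′P : y ≡ q′ * P
    y≡q′P = trans (m≡m%n+[m/n]*n y P) (cong (_+ q′ * P) y%P≡0)

    q′P≡ : q′ * P ≡ q * P + x
    q′P≡ = trans (sym y≡q′P) (trans (swap p x t) (cong (_+ x) p+t≡qP))
      where
      swap : ∀ x y z → x + y + z ≡ x + z + y
      swap = solve-∀

    marker<P : 3 + i <ⁿ P
    marker<P = ℕ.<-trans (ℕ.n<1+n _) (3+i<P∸1 (m%n<n q m))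

    i≡ : i ≡ q′ % m
    i≡ = marker-injective (q′ % m) i (trans (sym (f-block q′ (3 + i) marker<P))
      (trans (cong (λ z → f (z + (3 + i))) (sym y≡q′P)) (transfer (3 + i) marker<P (at-block i))))

  -- The two windows start 2^e (j′ - j) apart, which mP divides. Being odd, mP divides j′ - j < mP.
  aligned-injective : ∀ e → ¬ 2 ∣ m * P → 2 * P ≤ 2 ^ e → ∀ {j j′} → j ≤ j′ → j′ <ⁿ m * P →
    applyUpTo (λ t → f (j * 2 ^ e + t)) (2 ^ e) ≡ applyUpTo (λ t → f (j′ * 2 ^ e + t)) (2 ^ e) → j ≡ j′
  aligned-injective e odd 2P≤l {j} {j′} j≤j′ j′<mP eq = ℕ.≤-antisym j≤j′
    (ℕ.m∸n≡0⇒m≤n (small (j′ ∸ j) (ℕ.≤-<-trans (ℕ.m∸n≤m j′ j) j′<mP) mP∣))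
    where
    p′≡ : j′ * 2 ^ e ≡ j * 2 ^ e + 2 ^ e * (j′ ∸ j)
    p′≡ = trans (cong (_* 2 ^ e) (sym (ℕ.m+[n∸m]≡n j≤j′))) (trans (ℕ.*-distribʳ-+ (2 ^ e) j _) (cong (j * 2 ^ e +_) (ℕ.*-comm _ (2 ^ e))))
    mP∣ : m * P ∣ j′ ∸ j
    mP∣ = odd-cancel-2^ odd e (window-injective (j * 2 ^ e) _ (2 ^ e) 2P≤l
      λ {t} t<l → trans (applyUpTo-cancel (2 ^ e) eq t<l) (cong (λ z → f (z + t)) p′≡))
    small : ∀ y → y <ⁿ m * P → m * P ∣ y → y ≡ 0
    small zero    _     _  = refl
    small (suc y) y<mP mP∣y = contradiction (∣⇒≤ mP∣y) (ℕ.<⇒≱ y<mP)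

  blocks : ℕ → List (Fin k)
  blocks zero    = []
  blocks (suc i) = blocks i ++ block i

  blocks≡ : ∀ i → i ≤ m → blocks i ≡ applyUpTo f (i * P)
  blocks≡ zero    _   = refl
  blocks≡ (suc i) i<m = begin
    blocks i ++ block i                                    ≡⟨ cong₂ _++_ (blocks≡ i (ℕ.<⇒≤ i<m)) (sym (applyUpTo-at a (block i))) ⟩
    applyUpTo f (i * P) ++ applyUpTo (at a (block i)) (length (block i))
      ≡⟨ cong (λ z → applyUpTo f (i * P) ++ applyUpTo (at a (block i)) z) (length-block i (ℕ.<⇒≤ i<m)) ⟩
    applyUpTo f (i * P) ++ applyUpTo (at a (block i)) P
      ≡⟨ cong (applyUpTo f (i * P) ++_) (applyUpTo-cong P λ {r} r<P → trans (f-block i r r<P) (cong (λ z → at a (block z) r) (m<n⇒m%n≡m i<m))) ⟨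
    applyUpTo f (i * P) ++ applyUpTo (λ r → f (i * P + r)) P ≡⟨ applyUpTo-+ f (i * P) P ⟨
    applyUpTo f (i * P + P)                                ≡⟨ cong (applyUpTo f) (ℕ.+-comm (i * P) P) ⟩
    applyUpTo f (suc i * P)                                ∎
    where open Relation.Binary.PropositionalEquality.≡-Reasoning

  doubling≡ : ∀ e → doubling e (blocks m) ≡ applyUpTo f (2 ^ e * (m * P))
  doubling≡ zero    = trans (blocks≡ m ℕ.≤-refl) (cong (applyUpTo f) (sym (ℕ.*-identityˡ _)))
  doubling≡ (suc e) = begin
    doubling e (blocks m) ++ doubling e (blocks m)            ≡⟨ cong₂ _++_ (doubling≡ e) (doubling≡ e) ⟩
    applyUpTo f (2 ^ e * (m * P)) ++ applyUpTo f (2 ^ e * (m * P))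
      ≡⟨ cong (applyUpTo f (2 ^ e * (m * P)) ++_) (applyUpTo-cong (2 ^ e * (m * P)) λ {i} _ → f-periodic (2 ^ e) i) ⟨
    applyUpTo f (2 ^ e * (m * P)) ++ applyUpTo (λ i → f (2 ^ e * (m * P) + i)) (2 ^ e * (m * P)) ≡⟨ applyUpTo-+ f (2 ^ e * (m * P)) _ ⟨
    applyUpTo f (2 ^ e * (m * P) + 2 ^ e * (m * P))           ≡⟨ cong (applyUpTo f) (eq (2 ^ e) (m * P)) ⟩
    applyUpTo f (2 ^ suc e * (m * P))                         ∎
    where
    open Relation.Binary.PropositionalEquality.≡-Reasoning
    eq : ∀ x y → x * y + x * y ≡ 2 * x * y
    eq = solve-∀

-- While `w` is longer than 2^e, its left part has a multiple of 2^e as its length. So an aligned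
-- block lies wholly in one part and stays aligned there. `1 ≤ e` is what keeps the block from being
-- a single letter, which does not arise.
aligned-factor-arises : ∀ {k} (w : Word k) ac e j → 1 ≤ e → suc j * 2 ^ e ≤ length⁺ w →
  ∃ λ u → u ∈ arising′ w ac × toList u ≡ factor (2 ^ e) (j * 2 ^ e) (toList w)
aligned-factor-arises (_ ∷ []) ac e j 1≤e fits with s≤s () ← ℕ.≤-trans (ℕ.^-monoʳ-≤ 2 1≤e) (ℕ.≤-trans (ℕ.m≤m+n (2 ^ e) (j * 2 ^ e)) fits)
aligned-factor-arises {k} w@(a ∷ b ∷ s) ac@(acc rs) e j 1≤e fits =
  [ whole , inner ]′ (ℕ.≤-<-connex (length⁺ w) l)
  where
  l = 2 ^ e
  open Split (split a b s) renaming (j to J)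

  Result : Set
  Result = ∃ λ u → u ∈ arising′ w ac × toList u ≡ factor l (j * l) (toList w)

  whole : length⁺ w ≤ l → Result
  whole w≤l = w , here refl , sym (trans (cong (λ p → factor l p (toList w)) jl≡0) (List.take-all l (toList w) w≤l))
    where
    jl≡0 : j * l ≡ 0
    jl≡0 = ℕ.n≤0⇒n≡0 (ℕ.+-cancelˡ-≤ l _ _ (subst (l + j * l ≤_) (sym (ℕ.+-identityʳ l)) (ℕ.≤-trans fits w≤l)))

  inner : l <ⁿ length⁺ w → Result
  inner l<w = [ inLeft , inRight ]′ (ℕ.≤-<-connex (suc j) c)
    where
    c = 2 ^ (J ∸ e)

    |left|≡ : length⁺ left ≡ c * l
    |left|≡ = trans |left| (trans (cong (2 ^_) (sym (ℕ.m∸n+n≡m (2^-cancel-≤ {e} {J} (2^≤left (split a b s) {e} l<w))))) (ℕ.^-distribˡ-+-* 2 (J ∸ e) e))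

    inLeft : suc j ≤ c → Result
    inLeft sj≤c =
      let u , u∈ , eq = aligned-factor-arises left (rs left<) e j 1≤e (subst (suc j * l ≤_) (sym |left|≡) (ℕ.*-monoˡ-≤ l sj≤c))
      in u , there (∈-++⁺ˡ u∈) , trans eq (trans
        (sym (factor-++ˡ l (j * l) (toList left) (toList right) (subst₂ _≤_ (ℕ.+-comm l (j * l)) (sym |left|≡) (ℕ.*-monoˡ-≤ l sj≤c))))
        (cong (factor l (j * l)) left++right))

    inRight : c <ⁿ suc j → Result
    inRight (s≤s c≤j) =
      let u , u∈ , eq = aligned-factor-arises right (rs right<) e (j ∸ c) 1≤e
            (ℕ.+-cancelˡ-≤ (c * l) _ _ (subst₂ _≤_ fits≡ (trans (sym |w|≡) (cong (_+ length⁺ right) |left|≡)) fits))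
      in u , there (∈-++⁺ʳ (arising′ left _) u∈) , trans eq (trans (cong (λ p → factor l p (toList right)) offset)
        (trans (sym (factor-++ʳ l (j * l) (toList left) (toList right) (subst (_≤ j * l) (sym |left|≡) (ℕ.*-monoˡ-≤ l c≤j))))
          (cong (factor l (j * l)) left++right)))
      where
      fits≡ : suc j * l ≡ c * l + suc (j ∸ c) * l
      fits≡ = trans (cong (λ z → suc z * l) (sym (ℕ.m+[n∸m]≡n c≤j))) (trans (cong (_* l) (sym (ℕ.+-suc c (j ∸ c)))) (ℕ.*-distribʳ-+ l c (suc (j ∸ c))))
      offset : (j ∸ c) * l ≡ j * l ∸ length⁺ left
      offset = trans (ℕ.*-distribʳ-∸ l j c) (cong (j * l ∸_) (sym |left|≡))

length-arisingDistinct≥ : ∀ {k} (w : Word k) M (fac : ℕ → List (Fin k)) →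
  (∀ {j} → j <ⁿ M → ∃ λ u → u ∈ arising w × toList u ≡ fac j) →
  (∀ {i j} → i <ⁿ M → j <ⁿ M → fac i ≡ fac j → i ≡ j) → M ≤ length (arisingDistinct w)
length-arisingDistinct≥ w M fac arises fac-inj = Fin.injective⇒≤ {f = pos} λ {i} {j} eq →
  Fin.toℕ-injective (fac-inj (Fin.toℕ<n i) (Fin.toℕ<n j)
    (trans (sym (proj₂ (proj₂ (arises (Fin.toℕ<n i))))) (trans (cong toList (index-injective (at∈ i) (at∈ j) eq)) (proj₂ (proj₂ (arises (Fin.toℕ<n j)))))))
  where
  at∈ : (i : Fin M) → proj₁ (arises (Fin.toℕ<n i)) ∈ arisingDistinct w
  at∈ i = ∈-deduplicate⁺ _≟ʷ_ (proj₁ (proj₂ (arises (Fin.toℕ<n i))))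
  pos : Fin M → Fin (length (arisingDistinct w))
  pos i = index (at∈ i)

-- The hard word and a small grammar for it

toWord : ∀ {k} (xs : List (Fin k)) → 2 ≤ length xs → ∃ λ (w : Word k) → Long w × toList w ≡ xs
toWord (a ∷ b ∷ t) _ = a ∷ b ∷ t , long a b t , refl
toWord (a ∷ [])    (s≤s ())

module HardWord {k} (a b : Fin k) (a≢b : a ≢ b) (m′ pad e r E : ℕ)
  (1≤e : 1 ≤ e) (pad<2^E : pad <ⁿ 2 ^ E) (r<2^E : r <ⁿ 2 ^ E)
  (odd : ¬ 2 ∣ PeriodicWord.m a b a≢b m′ pad * PeriodicWord.P a b a≢b m′ pad)
  (2P≤2^e : 2 * PeriodicWord.P a b a≢b m′ pad ≤ 2 ^ e) where

  open PeriodicWord a b a≢b m′ pad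

  letters : List (Fin k)
  letters = doubling e (blocks m) ++ replicate r a

  length-letters : length letters ≡ 2 ^ e * (m * P) + r
  length-letters = trans (List.length-++ (doubling e (blocks m)))
    (cong₂ _+_ (trans (cong length (doubling≡ e)) (List.length-applyUpTo f (2 ^ e * (m * P)))) (List.length-replicate r))

  2≤length-letters : 2 ≤ length letters
  2≤length-letters = subst (2 ≤_) (sym length-letters)
    (ℕ.≤-trans (ℕ.*-mono-≤ (ℕ.^-monoʳ-≤ 2 1≤e) (s≤s (z≤n {3 + (m + pad) + m′ * P}))) (ℕ.m≤m+n _ r))

  word : Word k
  word = proj₁ (toWord letters 2≤length-letters)

  word-long : Long word
  word-long = proj₁ (proj₂ (toWord letters 2≤length-letters))

  word≡ : toList word ≡ letters
  word≡ = proj₂ (proj₂ (toWord letters 2≤length-letters))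

  length-word : length⁺ word ≡ 2 ^ e * (m * P) + r
  length-word = trans (cong length word≡) length-letters

  Pieces : List (Fin k) → Set
  Pieces u = (∃ λ j → j ≤ m × u ≡ replicate j a) ⊎ u ≡ replicate pad a

  -- Seven rules per block, one for each factor in the concatenation below; `3 * E + 2 * m` pays
  -- once for the shared pieces.
  gen-blocks : ∀ i → i ≤ m → Gen (7 * i + (3 * E + 2 * m)) (λ u → Pieces u ⊎ u ≡ blocks i)
  gen-blocks zero    _   = gen-weaken ℕ.≤-refl (λ { (inj₁ p) → base p ; (inj₂ refl) → empty }) (gen-replicate a E pad pad<2^E (gen-runs a m))
  gen-blocks (suc i) i<m = gen-weaken (ℕ.≤-reflexive (eq i (3 * E + 2 * m)))
    (λ { (inj₁ p) → base (inj₁ (inj₁ p)) ; (inj₂ refl) → base (inj₂ blocks-suc) })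
    (gen-concat (blocks i ∷ (b ∷ []) ∷ (b ∷ []) ∷ replicate (suc i) a ∷ (b ∷ []) ∷ replicate (m ∸ i) a ∷ replicate pad a ∷ [])
      (base (inj₂ refl) ∷ letter b ∷ letter b ∷ base (inj₁ (inj₁ (suc i , i<m , refl))) ∷ letter b ∷
        base (inj₁ (inj₁ (m ∸ i , ℕ.m∸n≤m m i , refl))) ∷ base (inj₁ (inj₂ refl)) ∷ [])
      (gen-blocks i (ℕ.<⇒≤ i<m)))
    where
    eq : ∀ i c → 7 + (7 * i + c) ≡ 7 * suc i + c
    eq = solve-∀
    blocks-suc : blocks (suc i) ≡ concat (blocks i ∷ (b ∷ []) ∷ (b ∷ []) ∷ replicate (suc i) a ∷ (b ∷ []) ∷ replicate (m ∸ i) a ∷ replicate pad a ∷ [])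
    blocks-suc = cong (λ z → blocks i ++ b ∷ b ∷ a ∷ replicate i a ++ b ∷ replicate (m ∸ i) a ++ z) (sym (List.++-identityʳ _))

  gen-letters : Gen (2 + (3 * E + (2 * e + (7 * m + (3 * E + 2 * m))))) (_≡ letters)
  gen-letters = gen-weaken ℕ.≤-refl (λ { refl → base (inj₂ (cong (doubling e (blocks m) ++_) (sym (List.++-identityʳ _)))) })
    (gen-concat (doubling e (blocks m) ∷ replicate r a ∷ []) (base (inj₁ refl) ∷ base (inj₂ refl) ∷ [])
      (gen-replicate a E r r<2^E (gen-doubling (blocks m) e (inj₂ refl) (gen-blocks m ℕ.≤-refl))))

  g-word≤ : g word ≤ (2 + (3 * E + (2 * e + (7 * m + (3 * E + 2 * m))))) * 2
  g-word≤ = gen⇒g≤ word word-long word≡ gen-letters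

  window : ℕ → List (Fin k)
  window j = applyUpTo (λ t → f (j * 2 ^ e + t)) (2 ^ e)

  window-fits : ∀ {j} → j <ⁿ m * P → j * 2 ^ e + 2 ^ e ≤ 2 ^ e * (m * P)
  window-fits {j} j<mP = subst₂ _≤_ (ℕ.+-comm (2 ^ e) (j * 2 ^ e)) (ℕ.*-comm (m * P) (2 ^ e)) (ℕ.*-monoˡ-≤ (2 ^ e) j<mP)

  window-arises : ∀ {j} → j <ⁿ m * P → ∃ λ u → u ∈ arising word × toList u ≡ window j
  window-arises {j} j<mP =
    let u , u∈ , eq = aligned-factor-arises word (<-wellFounded (length⁺ word)) e j 1≤e
          (subst₂ _≤_ (ℕ.+-comm (j * 2 ^ e) (2 ^ e)) (sym length-word) (ℕ.≤-trans (window-fits j<mP) (ℕ.m≤m+n _ r)))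
    in u , u∈ , trans eq (trans (cong (factor (2 ^ e) (j * 2 ^ e)) (trans word≡ (cong (_++ replicate r a) (doubling≡ e))))
      (trans (factor-++ˡ (2 ^ e) (j * 2 ^ e) (applyUpTo f (2 ^ e * (m * P))) _ (subst (j * 2 ^ e + 2 ^ e ≤_) (sym (List.length-applyUpTo f _)) (window-fits j<mP)))
        (factor-applyUpTo f (2 ^ e) (j * 2 ^ e) _ (window-fits j<mP))))

  window-inj : ∀ {i j} → i <ⁿ m * P → j <ⁿ m * P → window i ≡ window j → i ≡ j
  window-inj {i} {j} i< j< eq with ℕ.≤-total i j
  ... | inj₁ i≤j = aligned-injective e odd 2P≤2^e i≤j j< eq
  ... | inj₂ j≤i = sym (aligned-injective e odd 2P≤2^e j≤i i< (sym eq))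

  size-bisection≥ : m * P * 2 ≤ size (proj₁ (bisection word))
  size-bisection≥ = subst (m * P * 2 ≤_) (sym (size-bisection word word-long))
    (ℕ.*-monoˡ-≤ 2 (length-arisingDistinct≥ word (m * P) window window-arises window-inj))

-- Choice of the parameters

square : ℕ → ℕ
square t = t * t

-- Yields a power of two within a factor 2 of √(n / c). With c = 1 it defines h; with c of order log
-- n it gives the approximations of √(n / log n).
4^-floor : ∀ c n → 1 ≤ c → c ≤ n → ∃ λ e → c * square (2 ^ e) ≤ n × n <ⁿ c * square (2 ^ suc e)
4^-floor c n 1≤c c≤n = search n (ℕ.<-≤-trans (n<2^n n) (ℕ.≤-trans (ℕ.m≤m*n (2 ^ n) (2 ^ n) {{ℕ.m^n≢0 2 n}}) (ℕ.m≤n*m _ c {{>-nonZero 1≤c}})))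
  where
  search : ∀ u → n <ⁿ c * square (2 ^ u) → ∃ λ e → c * square (2 ^ e) ≤ n × n <ⁿ c * square (2 ^ suc e)
  search zero    n<c = contradiction c≤n (ℕ.<⇒≱ (subst (n <ⁿ_) (ℕ.*-identityʳ c) n<c))
  search (suc u) n<  with c * square (2 ^ u) ≤? n
  ... | yes ≤n = u , ≤n , n<
  ... | no ≰n  = search u (ℕ.≰⇒> ≰n)

cube : ℕ → ℕ
cube y = y * y * y

-- This is 128 (3 + h)³ ≤ 4^h for h = 9 + i, the reason why blocks fit into half a window. It fails
-- for h = 8, whence the threshold 4^9.
128cube≤4^ : ∀ i → 128 * cube (12 + i) ≤ square (2 ^ (9 + i))
128cube≤4^ zero    = ℕ.≤ᵇ⇒≤ _ _ _
128cube≤4^ (suc i) = begin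
  -- `grow` exhibits the slack in (3 + z)³ ≤ 4 (2 + z)³, used at z = 10 + i.
  128 * cube (12 + suc i)           ≤⟨ ℕ.*-monoʳ-≤ 128 (subst₂ _≤_ (cong cube (sym (ℕ.+-suc 12 i))) (sym (grow (10 + i))) (ℕ.m≤m+n _ _)) ⟩
  128 * (4 * cube (12 + i))         ≡⟨ swap (cube (12 + i)) ⟩
  4 * (128 * cube (12 + i))         ≤⟨ ℕ.*-monoʳ-≤ 4 (128cube≤4^ i) ⟩
  4 * square (2 ^ (9 + i))          ≡⟨ double (2 ^ (9 + i)) ⟩
  square (2 * 2 ^ (9 + i))          ≡⟨ cong (λ z → square (2 ^ z)) (ℕ.+-suc 9 i) ⟨
  square (2 ^ (9 + suc i))          ∎
  where
  open ℕ.≤-Reasoning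
  grow : ∀ z → 4 * ((2 + z) * (2 + z) * (2 + z)) ≡ (3 + z) * (3 + z) * (3 + z) + (5 + 21 * z + 15 * (z * z) + 3 * (z * z * z))
  grow = solve-∀
  swap : ∀ z → 128 * (4 * z) ≡ 4 * (128 * z)
  swap = solve-∀
  double : ∀ z → 4 * (z * z) ≡ 2 * z * (2 * z)
  double = solve-∀

square-2^ : ∀ e → square (2 ^ e) ≡ 2 ^ (2 * e)
square-2^ e = trans (sym (ℕ.^-distribˡ-+-* 2 e e)) (cong (λ z → 2 ^ (e + z)) (sym (ℕ.+-identityʳ e)))

module Bounds (n h : ℕ) (9≤h : 9 ≤ h) (4^h≤n : 2 ^ (2 * h) ≤ n) (n<4^1+h : n <ⁿ 2 ^ (2 * suc h)) where

  1≤h : 1 ≤ h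
  1≤h = ℕ.≤-trans (s≤s z≤n) 9≤h

  2[1+h]≤4h : 2 * suc h ≤ 4 * h
  2[1+h]≤4h = subst₂ _≤_ (eq₁ h) (eq₂ h) (ℕ.+-monoʳ-≤ (2 * h) (ℕ.*-monoʳ-≤ 2 1≤h))
    where
    eq₁ : ∀ h → 2 * h + 2 * 1 ≡ 2 * suc h
    eq₁ = solve-∀
    eq₂ : ∀ h → 2 * h + 2 * h ≡ 4 * h
    eq₂ = solve-∀

  2[1+h]≤n : 2 * suc h ≤ n
  2[1+h]≤n = begin
    2 * suc h      ≤⟨ ℕ.*-mono-≤ (ℕ.^-monoʳ-≤ 2 1≤h) (n<2^n h) ⟩
    2 ^ h * 2 ^ h  ≡⟨ square-2^ h ⟩
    2 ^ (2 * h)    ≤⟨ 4^h≤n ⟩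
    n              ∎
    where open ℕ.≤-Reasoning

  2h≤g : ∀ {k} (w : Word k) → length⁺ w ≡ n → 2 * h ≤ g w
  2h≤g w |w|≡n = 2^-cancel-≤ {2 * h} {g w} (ℕ.≤-trans 4^h≤n (subst (_≤ 2 ^ g w) |w|≡n (n≤2^g w)))

  module Upper (a : ℕ) (n< : n <ⁿ 2 * suc h * square (2 ^ suc a)) where

    size≤ : ∀ {k} (w : Word k) → length⁺ w ≡ n → size (proj₁ (bisection w)) ≤ 40 * (2 ^ a * g w)
    size≤ w |w|≡n = bisection-size≤ w a (proj₁ (g-isLeast w)) (begin
      length⁺ w                               ≡⟨ |w|≡n ⟩
      n                                       ≤⟨ ℕ.<⇒≤ n< ⟩
      2 * suc h * square (2 * 2 ^ a)          ≤⟨ ℕ.*-monoˡ-≤ (square (2 * 2 ^ a)) 2[1+h]≤4h ⟩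
      4 * h * square (2 * 2 ^ a)              ≡⟨ eq h (2 ^ a) ⟩
      8 * (2 ^ a * 2 ^ a * (2 * h))           ≤⟨ ℕ.*-monoʳ-≤ 8 (ℕ.*-monoʳ-≤ (2 ^ a * 2 ^ a) (2h≤g w |w|≡n)) ⟩
      8 * (2 ^ a * 2 ^ a * g w)               ∎)
      where
      open ℕ.≤-Reasoning
      eq : ∀ h t → 4 * h * (2 * t * (2 * t)) ≡ 8 * (t * t * (2 * h))
      eq = solve-∀

  -- The odd number between the bounds 2h and 2h + 2 of log₂ n.
  m : ℕ
  m = suc (2 * h)

  m≤n : m ≤ n
  m≤n = ℕ.≤-trans (n<2^n (2 * h)) 4^h≤n

  module Lower (e : ℕ) (m4^e≤n : m * square (2 ^ e) ≤ n) (n< : n <ⁿ m * square (2 ^ suc e)) where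

    n≤s²log : n ≤ square (4 * 2 ^ e) * (2 * h)
    n≤s²log = begin
      n                             ≤⟨ ℕ.<⇒≤ n< ⟩
      m * square (2 * 2 ^ e)
        ≤⟨ ℕ.*-monoˡ-≤ (square (2 * 2 ^ e)) (ℕ.≤-trans (ℕ.≤-trans (ℕ.n≤1+n m) (ℕ.≤-reflexive (sym (ℕ.*-suc 2 h)))) 2[1+h]≤4h) ⟩
      -- This is 8 · 4^e · 2h. Doubling it replaces 8 by the square 16, the origin of the 4 in
      -- `4 * 2 ^ e`.
      4 * h * square (2 * 2 ^ e)    ≤⟨ ℕ.m≤m+n _ _ ⟩
      4 * h * square (2 * 2 ^ e) + 4 * h * square (2 * 2 ^ e) ≡⟨ eq h (2 ^ e) ⟩
      square (4 * 2 ^ e) * (2 * h)  ∎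
      where
      open ℕ.≤-Reasoning
      eq : ∀ h t → 4 * h * (2 * t * (2 * t)) + 4 * h * (2 * t * (2 * t)) ≡ 4 * t * (4 * t) * (2 * h)
      eq = solve-∀

    -- As 4 (3 + h) = 2 (5 + m), this leaves room for a block of length 2^(e-1) - 1. Otherwise n
    -- would be at most 128 (3 + h)³, up to rounding absorbed in `n<`, against n ≥ 4^h.
    2^e-large : 4 * (3 + h) ≤ 2 ^ e
    2^e-large = ℕ.≮⇒≥ λ small → ℕ.<⇒≱ n< (begin
      m * square (2 * 2 ^ e)              ≤⟨ ℕ.*-mono-≤ m≤ (ℕ.*-mono-≤ (ℕ.*-monoʳ-≤ 2 (ℕ.<⇒≤ small)) (ℕ.*-monoʳ-≤ 2 (ℕ.<⇒≤ small))) ⟩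
      2 * (3 + h) * square (2 * (4 * (3 + h))) ≡⟨ eq (3 + h) ⟩
      128 * cube (3 + h)                  ≡⟨ cong (λ z → 128 * cube (3 + z)) (sym (ℕ.m+[n∸m]≡n 9≤h)) ⟩
      128 * cube (12 + (h ∸ 9))           ≤⟨ 128cube≤4^ (h ∸ 9) ⟩
      square (2 ^ (9 + (h ∸ 9)))          ≡⟨ cong (λ z → square (2 ^ z)) (ℕ.m+[n∸m]≡n 9≤h) ⟩
      square (2 ^ h)                      ≡⟨ square-2^ h ⟩
      2 ^ (2 * h)                         ≤⟨ 4^h≤n ⟩
      n                                   ∎)
      where
      open ℕ.≤-Reasoning
      m≤ : m ≤ 2 * (3 + h)
      m≤ = ℕ.≤-trans (ℕ.m≤n+m m 5) (ℕ.≤-reflexive (six h))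
        where
        six : ∀ h → 5 + suc (2 * h) ≡ 2 * (3 + h)
        six = solve-∀
      eq : ∀ y → 2 * y * (2 * (4 * y) * (2 * (4 * y))) ≡ 128 * (y * y * y)
      eq = solve-∀

  hardWord : ∀ {k} (a b : Fin k) → a ≢ b → ∀ e → m * square (2 ^ e) ≤ n → 4 * (3 + h) ≤ 2 ^ e →
    ∃ λ (w : Word k) → length⁺ w ≡ n × 4 * 2 ^ e * g w ≤ size (proj₁ (bisection w)) * 384
  hardWord a b a≢b zero       _       (s≤s ())
  hardWord a b a≢b (suc zero) _       (s≤s (s≤s ()))
  hardWord {k} a b a≢b e@(suc (suc e″)) m4^e≤n large = word , trans length-word (ℕ.m+[n∸m]≡n t*mP≤n) , (begin
      4 * t * g word                                    ≤⟨ ℕ.*-monoʳ-≤ (4 * t) g-word≤′ ⟩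
      4 * t * (48 * m)                                  ≤⟨ ℕ.*-monoˡ-≤ (48 * m) (ℕ.*-monoʳ-≤ 4 t≤4P) ⟩
      4 * (4 * P) * (48 * m)                            ≡⟨ eq₁ m P ⟩
      m * P * 2 * 384                                   ≤⟨ ℕ.*-monoˡ-≤ 384 size-bisection≥ ⟩
      size (proj₁ (bisection word)) * 384               ∎)
    where
    open ℕ.≤-Reasoning
    t = 2 ^ e
    u = 2 ^ suc e″
    -- Chosen so that P = u - 1.
    pad = u ∸ (5 + m)
    P = 4 + (m + pad)
    -- Since n < 2^E, this exponent bounds both `pad` and the final padding.
    E = 2 * suc h

    5+m≤u : 5 + m ≤ u
    5+m≤u = ℕ.*-cancelˡ-≤ 2 (subst (_≤ t) (eq h) large)
      where
      eq : ∀ h → 4 * (3 + h) ≡ 2 * (5 + suc (2 * h))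
      eq = solve-∀

    1+P≡u : suc P ≡ u
    1+P≡u = ℕ.m+[n∸m]≡n 5+m≤u

    P≤u : P ≤ u
    P≤u = ℕ.≤-trans (ℕ.n≤1+n P) (ℕ.≤-reflexive 1+P≡u)

    u≤t : u ≤ t
    u≤t = ℕ.m≤m+n u _

    t≤4P : t ≤ 4 * P
    t≤4P = begin
      2 * u            ≡⟨ cong (2 *_) (sym 1+P≡u) ⟩
      2 * suc P        ≤⟨ ℕ.*-monoʳ-≤ 2 (ℕ.+-monoˡ-≤ P (s≤s (z≤n {3 + (m + pad)}))) ⟩
      2 * (P + P)      ≡⟨ eq P ⟩
      4 * P            ∎
      where
      eq : ∀ x → 2 * (x + x) ≡ 4 * x
      eq = solve-∀

    odd : ¬ 2 ∣ m * P
    odd 2∣mP = >⇒∤ (s≤s (s≤s z≤n)) (∣m+n∣m⇒∣n {2} {2 * h} {1} (subst (2 ∣_) (ℕ.+-comm 1 (2 * h)) 2∣m) (m∣m*n h))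
      where
      2∣m : 2 ∣ m
      -- m (P + 1) = m u is even, so if mP were even, then so would be m = 2h + 1.
      2∣m = ∣m+n∣m⇒∣n (subst (2 ∣_)
        (trans (cong (m *_) (sym 1+P≡u)) (trans (ℕ.*-suc m P) (ℕ.+-comm m (m * P)))) (∣n⇒∣m*n m (m∣m*n (2 ^ e″)))) 2∣mP

    t≤n : t ≤ n
    t≤n = ℕ.≤-trans (ℕ.m≤m*n t t {{ℕ.m^n≢0 2 e}}) (ℕ.≤-trans (ℕ.m≤n*m (t * t) m) m4^e≤n)

    t*mP≤n : t * (m * P) ≤ n
    t*mP≤n = begin
      t * (m * P)     ≤⟨ ℕ.*-monoʳ-≤ t (ℕ.*-monoʳ-≤ m (ℕ.≤-trans P≤u u≤t)) ⟩
      t * (m * t)     ≡⟨ eq t m ⟩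
      m * square t    ≤⟨ m4^e≤n ⟩
      n               ∎
      where
      eq : ∀ t m → t * (m * t) ≡ m * (t * t)
      eq = solve-∀

    e≤h : e ≤ h
    e≤h = ℕ.m<1+n⇒m≤n (ℕ.*-cancelˡ-< 2 e (suc h) (2^-cancel-< {2 * e} {2 * suc h}
      (ℕ.≤-<-trans (subst (_≤ n) (square-2^ e) (ℕ.≤-trans (ℕ.m≤n*m (t * t) m) m4^e≤n)) n<4^1+h)))

    open HardWord a b a≢b (2 * h) pad e (n ∸ t * (m * P)) E (s≤s z≤n)
      (ℕ.≤-<-trans (ℕ.≤-trans (ℕ.m∸n≤m u (5 + m)) (ℕ.≤-trans u≤t t≤n)) n<4^1+h)
      (ℕ.≤-<-trans (ℕ.m∸n≤m n (t * (m * P))) n<4^1+h)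
      odd (ℕ.*-monoʳ-≤ 2 P≤u)

    g-word≤′ : g word ≤ 48 * m
    g-word≤′ = begin
      g word                                                             ≤⟨ g-word≤ ⟩
      (2 + (3 * E + (2 * e + (7 * m + (3 * E + 2 * m))))) * 2
        ≤⟨ ℕ.*-monoˡ-≤ 2 (ℕ.+-monoʳ-≤ 2 (ℕ.+-monoʳ-≤ (3 * E) (ℕ.+-monoˡ-≤ (7 * m + (3 * E + 2 * m)) (ℕ.*-monoʳ-≤ 2 e≤h)))) ⟩
      -- The value is 64h + 46; adding 32h + 2 rounds it up to a multiple of m.
      (2 + (3 * E + (2 * h + (7 * m + (3 * E + 2 * m))))) * 2            ≤⟨ ℕ.m≤m+n _ (32 * h + 2) ⟩
      (2 + (3 * E + (2 * h + (7 * m + (3 * E + 2 * m))))) * 2 + (32 * h + 2) ≡⟨ eq h ⟩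
      48 * m                                                             ∎
      where
      eq : ∀ h → (2 + (3 * (2 * suc h) + (2 * h + (7 * suc (2 * h) + (3 * (2 * suc h) + 2 * suc (2 * h)))))) * 2 + (32 * h + 2) ≡ 48 * suc (2 * h)
      eq = solve-∀

    eq₁ : ∀ m P → 4 * (4 * P) * (48 * m) ≡ m * P * 2 * 384
    eq₁ = solve-∀

-- Rational bounds

length-lists : ∀ k n {xs} → xs ∈ lists k n → length xs ≡ n
length-lists k zero    (here refl) = refl
length-lists k (suc n) xs∈ with _ , _ , _ , ys∈ , refl ← ∈-cartesianProductWith⁻ _∷_ (allFin k) (lists k n) xs∈ =
  cong suc (length-lists k n ys∈)

length-words : ∀ k n {w} → w ∈ words k n → length⁺ w ≡ n
length-words k (suc n) w∈ with _ , _ , _ , ys∈ , refl ← ∈-cartesianProductWith⁻ _∷_ (allFin k) (lists k n) w∈ =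
  cong suc (length-lists k n ys∈)

∈-lists : ∀ {k} (xs : List (Fin k)) → xs ∈ lists k (length xs)
∈-lists []       = here refl
∈-lists (x ∷ xs) = ∈-cartesianProductWith⁺ _∷_ (∈-allFin x) (∈-lists xs)

∈-words : ∀ {k n} (w : Word k) → length⁺ w ≡ n → w ∈ words k n
∈-words (x ∷ xs) refl = ∈-cartesianProductWith⁺ _∷_ (∈-allFin x) (∈-lists xs)

/-mono : ∀ a b c d .{{_ : NonZero b}} .{{_ : NonZero d}} → a * d ≤ c * b → ℤ.+ a /ℚ b ≤ℚ ℤ.+ c /ℚ d
/-mono a (suc b) c (suc d) ad≤cb = ℚ.toℚᵘ-cancel-≤ (begin
  toℚᵘ (ℤ.+ a /ℚ suc b)   ≃⟨ ℚ.toℚᵘ-fromℚᵘ (mkℚᵘ (ℤ.+ a) b) ⟩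
  mkℚᵘ (ℤ.+ a) b         ≤⟨ *≤* (subst₂ ℤ._≤_ (ℤ.pos-* a (suc d)) (ℤ.pos-* c (suc b)) (ℤ.+≤+ ad≤cb)) ⟩
  mkℚᵘ (ℤ.+ c) d         ≃⟨ ℚ.toℚᵘ-fromℚᵘ (mkℚᵘ (ℤ.+ c) d) ⟨
  toℚᵘ (ℤ.+ c /ℚ suc d)   ∎)
  where open ℚᵘ.≤-Reasoning

/-* : ∀ a b c d .{{_ : NonZero b}} .{{_ : NonZero d}} .{{_ : NonZero (b * d)}} → (ℤ.+ a /ℚ b) *ℚ (ℤ.+ c /ℚ d) ≡ ℤ.+ (a * c) /ℚ (b * d)
/-* a (suc b) c (suc d) = ℚ.toℚᵘ-injective (begin-equality
  toℚᵘ ((ℤ.+ a /ℚ suc b) *ℚ (ℤ.+ c /ℚ suc d))            ≃⟨ ℚ.toℚᵘ-homo-* (ℤ.+ a /ℚ suc b) (ℤ.+ c /ℚ suc d) ⟩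
  toℚᵘ (ℤ.+ a /ℚ suc b) ℚᵘ.* toℚᵘ (ℤ.+ c /ℚ suc d)       ≃⟨ ℚᵘ.*-cong (ℚ.toℚᵘ-fromℚᵘ (mkℚᵘ (ℤ.+ a) b)) (ℚ.toℚᵘ-fromℚᵘ (mkℚᵘ (ℤ.+ c) d)) ⟩
  mkℚᵘ (ℤ.+ a) b ℚᵘ.* mkℚᵘ (ℤ.+ c) d                   ≡⟨ cong (λ i → mkℚᵘ i (d + b * suc d)) (ℤ.pos-* a c) ⟨
  mkℚᵘ (ℤ.+ (a * c)) (d + b * suc d)                 ≃⟨ ℚ.toℚᵘ-fromℚᵘ (mkℚᵘ (ℤ.+ (a * c)) (d + b * suc d)) ⟨
  toℚᵘ (ℤ.+ (a * c) /ℚ (suc b * suc d))               ∎)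
  where open ℚᵘ.≤-Reasoning

0≤/ : ∀ a b .{{_ : NonZero b}} → 0ℚ ≤ℚ ℤ.+ a /ℚ b
0≤/ a b = /-mono 0 1 a b z≤n

-- `Lower` refers to the normalised numerator and denominator; l / 1 is in lowest terms, so these
-- are l and 1.
log₂-lower : ∀ n l → 2 ^ l ≤ n → ℤ.+ l /ℚ 1 ≤ʳ log₂ n
log₂-lower n l 2^l≤n = 0≤/ l 1 , subst (ℝ⁺.Lower (log₂ n)) (sym (ℚ.normalize-coprime (Coprimality.sym (Coprimality.1-coprimeTo l))))
  (subst (2 ^ l ≤_) (sym (ℕ.^-identityʳ n)) 2^l≤n)

log₂-upper : ∀ n l → n ≤ 2 ^ l → log₂ n ʳ≤ ℤ.+ l /ℚ 1
log₂-upper n l n≤2^l = 0≤/ l 1 , subst (ℝ⁺.Upper (log₂ n)) (sym (ℚ.normalize-coprime (Coprimality.sym (Coprimality.1-coprimeTo l))))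
  (subst (_≤ 2 ^ l) (sym (ℕ.^-identityʳ n)) n≤2^l)

square≡ : ∀ s → (ℤ.+ s /ℚ 1) *ℚ (ℤ.+ s /ℚ 1) ≡ ℤ.+ (s * s) /ℚ 1
square≡ s = /-* s 1 s 1

-- An upper bound l of log₂ n gives the lower bound n / l of n / log₂ n; `√-upper` is dual.
√-lower : ∀ n s l → n ≤ 2 ^ l → s * s * l ≤ n → ℤ.+ s /ℚ 1 ≤ʳ √ (n ÷ log₂ n)
√-lower n s l n≤2^l s²l≤n = 0≤/ s 1 , subst (0ℚ ≤ℚ_) (sym (square≡ s)) (0≤/ (s * s) 1) , ℤ.+ l /ℚ 1 , log₂-upper n l n≤2^l ,
  subst (_≤ℚ ℤ.+ n /ℚ 1) (sym (trans (cong (_*ℚ (ℤ.+ l /ℚ 1)) (square≡ s)) (/-* (s * s) 1 l 1)))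
    (/-mono (s * s * l) 1 n 1 (ℕ.*-monoˡ-≤ 1 s²l≤n))

√-upper : ∀ n s l → 2 ^ l ≤ n → n ≤ s * s * l → √ (n ÷ log₂ n) ʳ≤ ℤ.+ s /ℚ 1
√-upper n s l 2^l≤n n≤s²l = 0≤/ s 1 , subst (0ℚ ≤ℚ_) (sym (square≡ s)) (0≤/ (s * s) 1) , ℤ.+ l /ℚ 1 , log₂-lower n l 2^l≤n ,
  subst (ℤ.+ n /ℚ 1 ≤ℚ_) (sym (trans (cong (_*ℚ (ℤ.+ l /ℚ 1)) (square≡ s)) (/-* (s * s) 1 l 1)))
    (/-mono n 1 (s * s * l) 1 (ℕ.*-monoˡ-≤ 1 n≤s²l))

0≤α : ∀ (𝒞 : Compressor) k n → 0ℚ ≤ℚ α 𝒞 k n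
0≤α 𝒞 k n = ⊥≤max 0ℚ (map (ratio 𝒞) (words k n))

ratio≤α : ∀ (𝒞 : Compressor) {k n} (w : Word k) → length⁺ w ≡ n → ratio 𝒞 w ≤ℚ α 𝒞 k n
ratio≤α 𝒞 {k} {n} w |w|≡n = All.lookup (xs≤max 0ℚ (map (ratio 𝒞) (words k n))) (∈-map⁺ (ratio 𝒞) (∈-words w |w|≡n))

≤ratio : ∀ (𝒞 : Compressor) {k} (w : Word k) c d .{{_ : NonZero d}} → c * g w ≤ size (proj₁ (𝒞 w)) * d → ℤ.+ c /ℚ d ≤ℚ ratio 𝒞 w
≤ratio 𝒞 w c d {{d≢0}} cg≤ = /-mono c d (size (proj₁ (𝒞 w))) (g w) {{d≢0}} {{g-nonZero w}} cg≤

ratio≤ : ∀ (𝒞 : Compressor) {k} (w : Word k) c → size (proj₁ (𝒞 w)) ≤ c * g w → ratio 𝒞 w ≤ℚ ℤ.+ c /ℚ 1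
ratio≤ 𝒞 w c ≤cg = /-mono (size (proj₁ (𝒞 w))) (g w) c 1 {{g-nonZero w}} (subst (_≤ c * g w) (sym (ℕ.*-identityʳ _)) ≤cg)

α≤ : ∀ (𝒞 : Compressor) k n {q} → 0ℚ ≤ℚ q → (∀ (w : Word k) → length⁺ w ≡ n → ratio 𝒞 w ≤ℚ q) → α 𝒞 k n ≤ℚ q
α≤ 𝒞 k n 0≤q ratio≤q = max≤v⁺ 0≤q (All.map⁺ {f = ratio 𝒞} (All.tabulate λ {w} w∈ → ratio≤q w (length-words k n w∈)))

theorem3p2 : ∃[ c₁ ] ∃[ c₂ ] ∃[ n₀ ] (0ℚ < c₁) × (0ℚ < c₂) ×
    (∀ (n k : ℕ) → n₀ ≤ n → 2 ≤ k → k ≤ n →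
    (c₁ · (√ (n ÷ log₂ n)) ʳ≤ α bisection k n) ×
    (α bisection k n ≤ʳ c₂ · (√ (n ÷ log₂ n))))
-- 40 is twice the 20 distinct words per unit of t g(w), as rules have two symbols. 384 comes from g
-- ≤ 48m, 2^e ≤ 4P and size at least 2mP.
theorem3p2 = ℤ.+ 1 /ℚ 384 , ℤ.+ 40 /ℚ 1 , 4 ^ 9 , ℚ.positive⁻¹ (ℤ.+ 1 /ℚ 384) , ℚ.positive⁻¹ (ℤ.+ 40 /ℚ 1) , bounds
  where
  bounds : ∀ n k → 4 ^ 9 ≤ n → 2 ≤ k → k ≤ n →
    ((ℤ.+ 1 /ℚ 384) · (√ (n ÷ log₂ n)) ʳ≤ α bisection k n) × (α bisection k n ≤ʳ (ℤ.+ 40 /ℚ 1) · (√ (n ÷ log₂ n)))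
  bounds n k@(suc (suc _)) n₀≤n (s≤s (s≤s _)) _ = lower , upper
    where
    log₄ = 4^-floor 1 n ℕ.≤-refl (ℕ.≤-trans (ℕ.m^n>0 4 9) n₀≤n)
    h = proj₁ log₄

    4^h≤n : 2 ^ (2 * h) ≤ n
    4^h≤n = subst (_≤ n) (trans (ℕ.*-identityˡ _) (square-2^ h)) (proj₁ (proj₂ log₄))

    n<4^1+h : n <ⁿ 2 ^ (2 * suc h)
    n<4^1+h = subst (n <ⁿ_) (trans (ℕ.*-identityˡ _) (square-2^ (suc h))) (proj₂ (proj₂ log₄))

    9≤h : 9 ≤ h
    9≤h = ℕ.m<1+n⇒m≤n (ℕ.*-cancelˡ-< 2 9 (suc h) (2^-cancel-< {18} {2 * suc h} (ℕ.≤-<-trans n₀≤n n<4^1+h)))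

    open Bounds n h 9≤h 4^h≤n n<4^1+h

    lower : (ℤ.+ 1 /ℚ 384) · (√ (n ÷ log₂ n)) ʳ≤ α bisection k n
    lower =
      let e , lo , hi = 4^-floor m n (s≤s z≤n) m≤n
          w , |w|≡n , bound = hardWord {k} zero (suc zero) (λ ()) e lo (Lower.2^e-large e lo hi)
          s = 4 * 2 ^ e
      in 0≤α bisection k n , ℤ.+ s /ℚ 1 , √-upper n s (2 * h) 4^h≤n (Lower.n≤s²log e lo hi) ,
         ℚ.≤-trans (ℚ.≤-reflexive (trans (/-* 1 384 s 1) (cong (λ z → ℤ.+ z /ℚ 384) (ℕ.*-identityˡ s))))
           (ℚ.≤-trans (≤ratio bisection w s 384 bound) (ratio≤α bisection w |w|≡n))

    upper : α bisection k n ≤ʳ (ℤ.+ 40 /ℚ 1) · (√ (n ÷ log₂ n))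
    upper =
      -- One choice of `a` serves twice: `lo` puts 2^a below √(n / log n), and `hi` is the
      -- hypothesis of the counting bound.
      let a , lo , hi = 4^-floor (2 * suc h) n (s≤s z≤n) 2[1+h]≤n
          s = 2 ^ a
      in 0≤α bisection k n , ℤ.+ s /ℚ 1 , √-lower n s (2 * suc h) (ℕ.<⇒≤ n<4^1+h) (subst (_≤ n) (ℕ.*-comm (2 * suc h) (square s)) lo) ,
         ℚ.≤-trans (α≤ bisection k n (0≤/ (40 * s) 1) λ w |w|≡n →
             ratio≤ bisection w (40 * s) (subst (size (proj₁ (bisection w)) ≤_) (sym (ℕ.*-assoc 40 s (g w))) (Upper.size≤ a hi w |w|≡n)))
           (ℚ.≤-reflexive (sym (/-* 40 1 s 1)))
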